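{- The birational map $\zeta=\varphi\tau\mu_{14}$ on $X_4$ defined in the context has infinite order (as an element of the group $\mathrm{Bir}(X_4)$ of birational maps on $X_4$).
   Context: $X_4$ is the affine variety over $\mathbb{Q}$ in coordinates $(x_1,x_2,x_3,x_4)$ defined by $x_4^2-2x_3^2+x_2^2=2$ and $x_3^2-2x_2^2+x_1^2=2$. Rational maps on $X_4$ are identified when they agree on a dense open subset of $X_4$. Products of maps denote composition. Let $\tau(a,b,c,d)=(d,c,b,a)$ and $\mu_{14}(a,b,c,d)=(-a,b,c,-d)$. Let $\varphi=\left(\frac{p_1}{q},\frac{p_2}{q},\frac{p_3}{q},\frac{p_4}{q}\right)$, where, in the variables $(a,b,c,d)$, $$q=(b-c)^2(a-2b+c),$$ $$p_1=-2ab^3+ab^2c+2ab^2d+4abc^2-5abcd+ab-2ac^3+2ac^2d+ac-ad+3b^4-2b^3c-3b^3d-6b^2c^2+8b^2cd+b^2+4bc^3-4bc^2d-5bc+bd+c^2+cd-2,$$ $$p_2=-2ab^2c+5abc^2-2abcd+2ab-2ac^3+ac^2d-ad+3b^3c-8b^2c^2+3b^2cd-2b^2+4bc^3-2bc^2d-bc+2bd-2,$$ $$p_3=-2ab^3+5ab^2c-2ab^2d-2abc^2+abcd+3ab-ac-ad+3b^4-8b^3c+3b^3d+4b^2c^2-2b^2cd-3b^2-bc+3bd+c^2-cd-2,$$ $$p_4=-3ab^3+8ab^2c-3ab^2d-4abc^2+2abcd+4ab-2ac-ad+4b^4-10b^3c+4b^3d+2b^2c^2-2b^2cd-4b^2+5bc^3-2bc^2d-bc+4bd-2c^4+c^3d+2c^2-2cd-2.$$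 Then $\varphi$ is a birational map on $X_4$, and $\zeta=\varphi\tau\mu_{14}$, i.e. $\zeta(a,b,c,d)=\varphi(-d,c,b,-a)$. -}

module Defs where

open import Algebra.Bundles using (CommutativeRing; Group)
import Algebra.Definitions.RawMonoid as RawMonoid
open import Algebra.Solver.Ring.AlmostCommutativeRing using (fromCommutativeRing; _-Raw-AlmostCommutative⟶_)
open import Data.Fin.Base using (Fin; zero; suc)
open import Data.Integer.Base using (+_)
open import Data.List.Base using (List; []; _∷_; map)
open import Data.Maybe.Base using (Maybe; just; nothing)
open import Data.Nat.Base using (ℕ; zero; suc; NonZero; _<_; s≤s)
import Data.Nat.Properties as ℕₚ
open import Data.Product.Base using (_×_; _,_; proj₁; proj₂; ∃-syntax)
open import Data.Rational.Base as ℚ using (ℚ; 0ℚ; 1ℚ)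
import Data.Rational.Properties as ℚₚ
import Data.Rational.Solver
open import Data.Vec.Base using (Vec; []; _∷_)
open import Function.Base using (_∘_)
open import Level using (0ℓ)
open import Relation.Binary.PropositionalEquality as ≡ using (_≡_)
open import Relation.Nullary.Decidable using (yes; no)
open import Relation.Nullary.Negation using (¬_)
import Algebra.Properties.Ring
import Algebra.Solver.Ring
import Relation.Binary.Reasoning.Setoid

infix  8 -_
infixl 7 _*_
infixl 6 _+_ _-_
infixr 9 _^_
infixr 8 _·_
infix  9 ♯_
infix  4 _≈_ _≃_

-- Polynomial expressions with rational coefficients in x₁, x₂, x₃, x₄.

data Poly : Set where
  con     : ℚ → Poly
  var     : Fin 4 → Poly
  _+_ _*_ : Poly → Poly → Poly
  -_      : Poly → Poly

pattern i₁ = zero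
pattern i₂ = suc zero
pattern i₃ = suc (suc zero)
pattern i₄ = suc (suc (suc zero))

0# 1# : Poly
0# = con 0ℚ
1# = con 1ℚ

_-_ : Poly → Poly → Poly
p - q = p + - q

_^_ : Poly → ℕ → Poly
p ^ zero        = 1#
p ^ suc zero    = p
p ^ suc (suc n) = p * p ^ suc n

♯_ : ℕ → Poly
♯ n = con (+ n ℚ./ 1)

_·_ : ℕ → Poly → Poly
n · p = ♯ n * p

x₁ x₂ x₃ x₄ : Poly
x₁ = var i₁
x₂ = var i₂
x₃ = var i₃
x₄ = var i₄

-- X₄ is the common zero locus of these two polynomials.

equation : Fin 2 → Poly
equation i₁ = x₄ ^ 2 - 2 · x₃ ^ 2 + x₂ ^ 2 - ♯ 2
equation i₂ = x₃ ^ 2 - 2 · x₂ ^ 2 + x₁ ^ 2 - ♯ 2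

-- Equality in ℚ[X₄] = ℚ[x₁,x₂,x₃,x₄]/(equation i₁, equation i₂):
-- the congruence generated by the axioms of commutative ℚ-algebras and the
-- defining equations.  The projective closure of X₄ is a smooth complete
-- intersection of two quadrics in ℙ⁴, so ℚ[X₄] is an integral domain and
-- p ≈ 0# says exactly that p vanishes on X₄.

data _≈_ : Poly → Poly → Set where
  refl         : ∀ {p} → p ≈ p
  sym          : ∀ {p q} → p ≈ q → q ≈ p
  trans        : ∀ {p q r} → p ≈ q → q ≈ r → p ≈ r
  +-cong       : ∀ {p q r s} → p ≈ q → r ≈ s → p + r ≈ q + s
  *-cong       : ∀ {p q r s} → p ≈ q → r ≈ s → p * r ≈ q * s
  -‿cong       : ∀ {p q} → p ≈ q → - p ≈ - q
  +-assoc      : ∀ p q r → (p + q) + r ≈ p + (q + r)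
  +-comm       : ∀ p q → p + q ≈ q + p
  +-identityˡ  : ∀ p → 0# + p ≈ p
  -‿inverseˡ   : ∀ p → - p + p ≈ 0#
  *-assoc      : ∀ p q r → (p * q) * r ≈ p * (q * r)
  *-comm       : ∀ p q → p * q ≈ q * p
  *-identityˡ  : ∀ p → 1# * p ≈ p
  distribˡ     : ∀ p q r → p * (q + r) ≈ p * q + p * r
  con-+        : ∀ a b → con (a ℚ.+ b) ≈ con a + con b
  con-*        : ∀ a b → con (a ℚ.* b) ≈ con a * con b
  equation≈0   : ∀ i → equation i ≈ 0#

ℚ[X₄] : CommutativeRing 0ℓ 0ℓ
ℚ[X₄] = record
  { Carrier = Poly ; _≈_ = _≈_ ; _+_ = _+_ ; _*_ = _*_ ; -_ = -_ ; 0# = 0# ; 1# = 1#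
  ; isCommutativeRing = record
    { isRing = record
      { +-isAbelianGroup = record
        { isGroup = record
          { isMonoid = record
            { isSemigroup = record
              { isMagma = record
                { isEquivalence = record { refl = refl ; sym = sym ; trans = trans }
                ; ∙-cong = +-cong }
              ; assoc = +-assoc }
            ; identity = +-identityˡ , λ p → trans (+-comm p 0#) (+-identityˡ p) }
          ; inverse = -‿inverseˡ , λ p → trans (+-comm p (- p)) (-‿inverseˡ p)
          ; ⁻¹-cong = -‿cong }
        ; comm = +-comm }
      ; *-cong = *-cong
      ; *-assoc = *-assoc
      ; *-identity = *-identityˡ , λ p → trans (*-comm p 1#) (*-identityˡ p)
      ; distrib = distribˡ , λ p q r → trans (*-comm (q + r) p)
          (trans (distribˡ p q r) (+-cong (*-comm p q) (*-comm p r))) }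
    ; *-comm = *-comm } }

module R = CommutativeRing ℚ[X₄]
module Rₚ = Algebra.Properties.Ring R.ring
module ≈-Reasoning = Relation.Binary.Reasoning.Setoid R.setoid

con-neg : ∀ a → con (ℚ.- a) ≈ - con a
con-neg a = Rₚ.+-inverseˡ-unique _ _
  (trans (sym (con-+ (ℚ.- a) a)) (R.reflexive (≡.cong con (ℚₚ.+-inverseˡ a))))

ℚ⟶ℚ[X₄] : ℚ.+-*-rawRing -Raw-AlmostCommutative⟶ fromCommutativeRing ℚ[X₄]
ℚ⟶ℚ[X₄] = record
  { ⟦_⟧ = con ; +-homo = con-+ ; *-homo = con-* ; -‿homo = con-neg
  ; 0-homo = refl ; 1-homo = refl }

con≟ : ∀ a b → Maybe (con a ≈ con b)
con≟ a b with a ℚₚ.≟ b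
... | yes eq = just (R.reflexive (≡.cong con eq))
... | no _   = nothing

module ℚ-Solver = Data.Rational.Solver.+-*-Solver

module S = Algebra.Solver.Ring ℚ.+-*-rawRing (fromCommutativeRing ℚ[X₄]) ℚ⟶ℚ[X₄] con≟

reify : Poly → S.Polynomial 4
reify (con a) = S.con a
reify (var i) = S.var i
reify (p + q) = reify p S.:+ reify q
reify (p * q) = reify p S.:* reify q
reify (- p)   = S.:- reify p

vars : Vec Poly 4
vars = x₁ ∷ x₂ ∷ x₃ ∷ x₄ ∷ []

≈0⇒≈ : ∀ {p q} → p - q ≈ 0# → p ≈ q
≈0⇒≈ {p} {q} eq = trans (Rₚ.+-inverseˡ-unique p (- q) eq) (Rₚ.-‿involutive q)

≈⇒≈0 : ∀ {p q} → p ≈ q → p - q ≈ 0#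
≈⇒≈0 {p} {q} eq = trans (+-cong eq refl) (R.-‿inverseʳ q)

-- The basic open set D(h) = {h ≠ 0} is dense in X₄ iff every g vanishing on
-- D(h), that is with h * g vanishing on X₄, vanishes on X₄.

Dense : Poly → Set
Dense h = ∀ g → h * g ≈ 0# → g ≈ 0#

opaque
  dense-* : ∀ {p q} → Dense p → Dense q → Dense (p * q)
  dense-* {p} {q} dp dq g eq = dq g (dp (q * g) (trans (sym (*-assoc p q g)) eq))

cancel : ∀ {d p q} → Dense d → d * p ≈ d * q → p ≈ q
cancel {d} {p} {q} dense eq = ≈0⇒≈ (dense (p - q)
  (trans (S.solve 3 (λ d p q → d S.:* (p S.:- q) S.:= d S.:* p S.:- d S.:* q) refl d p q)
         (≈⇒≈0 eq)))

dense-resp : ∀ {p q} → p ≈ q → Dense p → Dense q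
dense-resp eq dense g q*g≈0 = dense g (trans (*-cong eq refl) q*g≈0)

dense-1 : Dense 1#
dense-1 g eq = trans (sym (*-identityˡ g)) eq

dense-factorˡ : ∀ p {q} → Dense (p * q) → Dense p
dense-factorˡ p {q} dpq g eq = dpq g
  (trans (S.solve 3 (λ p q g → p S.:* q S.:* g S.:= q S.:* (p S.:* g)) refl p q g)
         (trans (*-cong refl eq) (R.zeroʳ q)))

dense-factorʳ : ∀ p {q} → Dense (p * q) → Dense q
dense-factorʳ p {q} d = dense-factorˡ q (dense-resp (*-comm p q) d)

-- The fraction num / den, regular on the dense open D(den).  As X₄ is affine and
-- irreducible, every rational function on X₄ is of this form.

record RationalFunction : Set where
  constructor frac
  field
    num den   : Poly
    den-dense : Dense den

open RationalFunction

-- Two rational functions are identified when they agree on a dense open set.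

record _≃_ (x y : RationalFunction) : Set where
  constructor agree
  field
    agreement : ∃[ h ] Dense h × h * (num x * den y) ≈ h * (num y * den x)

ι : Poly → RationalFunction
ι p = frac p 1# dense-1

cross : ∀ {x y} → x ≃ y → num x * den y ≈ num y * den x
cross (agree (_ , dense , eq)) = cancel dense eq

uncross : ∀ {x y} → num x * den y ≈ num y * den x → x ≃ y
uncross eq = agree (1# , dense-1 , *-cong refl eq)

infixl 6 _⊞_
infixl 7 _⊠_

_⊞_ _⊠_ : RationalFunction → RationalFunction → RationalFunction
frac n d dense ⊞ frac n′ d′ dense′ = frac (n * d′ + n′ * d) (d * d′) (dense-* dense dense′)
frac n d dense ⊠ frac n′ d′ dense′ = frac (n * n′) (d * d′) (dense-* dense dense′)

⊟_ : RationalFunction → RationalFunction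
⊟ frac n d dense = frac (- n) d dense

≃-refl : ∀ {x} → x ≃ x
≃-refl = uncross refl

≃-sym : ∀ {x y} → x ≃ y → y ≃ x
≃-sym eq = uncross (sym (cross eq))

≃-trans : ∀ {x y z} → x ≃ y → y ≃ z → x ≃ z
≃-trans {frac n₁ d₁ _} {frac n₂ d₂ D₂} {frac n₃ d₃ _} eq eq′ = uncross (cancel D₂ (begin
  d₂ * (n₁ * d₃)  ≈⟨ solve 3 (λ n₁ d₂ d₃ → d₂ :* (n₁ :* d₃) := n₁ :* d₂ :* d₃) refl n₁ d₂ d₃ ⟩
  n₁ * d₂ * d₃    ≈⟨ *-cong (cross eq) refl ⟩
  n₂ * d₁ * d₃    ≈⟨ solve 3 (λ n₂ d₁ d₃ → n₂ :* d₁ :* d₃ := n₂ :* d₃ :* d₁) refl n₂ d₁ d₃ ⟩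
  n₂ * d₃ * d₁    ≈⟨ *-cong (cross eq′) refl ⟩
  n₃ * d₂ * d₁    ≈⟨ solve 3 (λ n₃ d₂ d₁ → n₃ :* d₂ :* d₁ := d₂ :* (n₃ :* d₁)) refl n₃ d₂ d₁ ⟩
  d₂ * (n₃ * d₁)  ∎))
  where
  open ≈-Reasoning
  open S

⊞-cong : ∀ {x x′ y y′} → x ≃ x′ → y ≃ y′ → x ⊞ y ≃ x′ ⊞ y′
⊞-cong {frac n₁ d₁ _} {frac n₂ d₂ _} {frac n₃ d₃ _} {frac n₄ d₄ _} eq eq′ = uncross (begin
  (n₁ * d₃ + n₃ * d₁) * (d₂ * d₄)
    ≈⟨ solve 6 (λ n₁ d₁ d₂ n₃ d₃ d₄ → (n₁ :* d₃ :+ n₃ :* d₁) :* (d₂ :* d₄)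
         := n₁ :* d₂ :* (d₃ :* d₄) :+ n₃ :* d₄ :* (d₁ :* d₂)) refl n₁ d₁ d₂ n₃ d₃ d₄ ⟩
  n₁ * d₂ * (d₃ * d₄) + n₃ * d₄ * (d₁ * d₂)
    ≈⟨ +-cong (*-cong (cross eq) refl) (*-cong (cross eq′) refl) ⟩
  n₂ * d₁ * (d₃ * d₄) + n₄ * d₃ * (d₁ * d₂)
    ≈⟨ solve 6 (λ d₁ n₂ d₂ d₃ n₄ d₄ → n₂ :* d₁ :* (d₃ :* d₄) :+ n₄ :* d₃ :* (d₁ :* d₂)
         := (n₂ :* d₄ :+ n₄ :* d₂) :* (d₁ :* d₃)) refl d₁ n₂ d₂ d₃ n₄ d₄ ⟩
  (n₂ * d₄ + n₄ * d₂) * (d₁ * d₃)  ∎)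
  where
  open ≈-Reasoning
  open S

⊠-cong : ∀ {x x′ y y′} → x ≃ x′ → y ≃ y′ → x ⊠ y ≃ x′ ⊠ y′
⊠-cong {frac n₁ d₁ _} {frac n₂ d₂ _} {frac n₃ d₃ _} {frac n₄ d₄ _} eq eq′ = uncross (begin
  n₁ * n₃ * (d₂ * d₄)    ≈⟨ swap n₁ n₃ d₂ d₄ ⟩
  n₁ * d₂ * (n₃ * d₄)    ≈⟨ *-cong (cross eq) (cross eq′) ⟩
  n₂ * d₁ * (n₄ * d₃)    ≈⟨ swap n₂ d₁ n₄ d₃ ⟩
  n₂ * n₄ * (d₁ * d₃)    ∎)
  where
  open ≈-Reasoning
  open S
  swap : ∀ p q r s → p * q * (r * s) ≈ p * r * (q * s)
  swap = solve 4 (λ p q r s → p :* q :* (r :* s) := p :* r :* (q :* s)) refl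

⊟-cong : ∀ {x y} → x ≃ y → ⊟ x ≃ ⊟ y
⊟-cong {frac n₁ d₁ _} {frac n₂ d₂ _} eq = uncross
  (trans (sym (Rₚ.-‿distribˡ-* n₁ d₂)) (trans (-‿cong (cross eq)) (Rₚ.-‿distribˡ-* n₂ d₁)))

⊞-identityˡ : ∀ x → ι 0# ⊞ x ≃ x
⊞-identityˡ (frac n d _) = uncross
  (solve 2 (λ n d → (con 0ℚ :* d :+ n :* con 1ℚ) :* d := n :* (con 1ℚ :* d)) refl n d)
  where
  open S

⊞-comm : ∀ x y → x ⊞ y ≃ y ⊞ x
⊞-comm (frac n₁ d₁ _) (frac n₂ d₂ _) = uncross
  (solve 4 (λ n₁ d₁ n₂ d₂ → (n₁ :* d₂ :+ n₂ :* d₁) :* (d₂ :* d₁)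
    := (n₂ :* d₁ :+ n₁ :* d₂) :* (d₁ :* d₂)) refl n₁ d₁ n₂ d₂)
  where
  open S

⊟-inverseˡ : ∀ x → ⊟ x ⊞ x ≃ ι 0#
⊟-inverseˡ (frac n d _) = uncross
  (solve 2 (λ n d → (:- n :* d :+ n :* d) :* con 1ℚ := con 0ℚ :* (d :* d)) refl n d)
  where
  open S

⊠-identityˡ : ∀ x → ι 1# ⊠ x ≃ x
⊠-identityˡ (frac n d _) = uncross
  (solve 2 (λ n d → con 1ℚ :* n :* d := n :* (con 1ℚ :* d)) refl n d)
  where
  open S

⊠-comm : ∀ x y → x ⊠ y ≃ y ⊠ x
⊠-comm (frac n₁ d₁ _) (frac n₂ d₂ _) = uncross (*-cong (*-comm n₁ n₂) (*-comm d₂ d₁))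

⊠-distribˡ : ∀ x y z → x ⊠ (y ⊞ z) ≃ x ⊠ y ⊞ x ⊠ z
⊠-distribˡ (frac n₁ d₁ _) (frac n₂ d₂ _) (frac n₃ d₃ _) = uncross
  (solve 6 (λ n₁ d₁ n₂ d₂ n₃ d₃ →
    n₁ :* (n₂ :* d₃ :+ n₃ :* d₂) :* (d₁ :* d₂ :* (d₁ :* d₃))
    := (n₁ :* n₂ :* (d₁ :* d₃) :+ n₁ :* n₃ :* (d₁ :* d₂)) :* (d₁ :* (d₂ :* d₃)))
    refl n₁ d₁ n₂ d₂ n₃ d₃)
  where
  open S

⊞-assoc : ∀ x y z → x ⊞ y ⊞ z ≃ x ⊞ (y ⊞ z)
⊞-assoc (frac n₁ d₁ _) (frac n₂ d₂ _) (frac n₃ d₃ _) = uncross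
  (solve 6 (λ n₁ d₁ n₂ d₂ n₃ d₃ →
    ((n₁ :* d₂ :+ n₂ :* d₁) :* d₃ :+ n₃ :* (d₁ :* d₂)) :* (d₁ :* (d₂ :* d₃))
    := (n₁ :* (d₂ :* d₃) :+ (n₂ :* d₃ :+ n₃ :* d₂) :* d₁) :* (d₁ :* d₂ :* d₃))
    refl n₁ d₁ n₂ d₂ n₃ d₃)
  where
  open S

⊠-assoc : ∀ x y z → x ⊠ y ⊠ z ≃ x ⊠ (y ⊠ z)
⊠-assoc (frac n₁ d₁ _) (frac n₂ d₂ _) (frac n₃ d₃ _) = uncross
  (*-cong (*-assoc n₁ n₂ n₃) (sym (*-assoc d₁ d₂ d₃)))

ℚ⟨X₄⟩ : CommutativeRing 0ℓ 0ℓ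
ℚ⟨X₄⟩ = record
  { Carrier = RationalFunction
  ; _≈_ = _≃_ ; _+_ = _⊞_ ; _*_ = _⊠_ ; -_ = ⊟_ ; 0# = ι 0# ; 1# = ι 1#
  ; isCommutativeRing = record
    { isRing = record
      { +-isAbelianGroup = record
        { isGroup = record
          { isMonoid = record
            { isSemigroup = record
              { isMagma = record
                { isEquivalence = record { refl = ≃-refl ; sym = ≃-sym ; trans = ≃-trans }
                ; ∙-cong = ⊞-cong }
              ; assoc = ⊞-assoc }
            ; identity = ⊞-identityˡ , λ x → ≃-trans (⊞-comm x (ι 0#)) (⊞-identityˡ x) }
          ; inverse = ⊟-inverseˡ , λ x → ≃-trans (⊞-comm x (⊟ x)) (⊟-inverseˡ x)
          ; ⁻¹-cong = ⊟-cong }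
        ; comm = ⊞-comm }
      ; *-cong = ⊠-cong
      ; *-assoc = ⊠-assoc
      ; *-identity = ⊠-identityˡ , λ x → ≃-trans (⊠-comm x (ι 1#)) (⊠-identityˡ x)
      ; distrib = ⊠-distribˡ , λ x y z → ≃-trans (⊠-comm (y ⊞ z) x)
          (≃-trans (⊠-distribˡ x y z) (⊞-cong (⊠-comm x y) (⊠-comm x z))) }
    ; *-comm = ⊠-comm } }

module K = CommutativeRing ℚ⟨X₄⟩
module Kₚ = Algebra.Properties.Ring K.ring
module ≃-Reasoning = Relation.Binary.Reasoning.Setoid K.setoid

ι-cong : ∀ {p q} → p ≈ q → ι p ≃ ι q
ι-cong eq = uncross (*-cong eq refl)

ι-injective : ∀ {p q} → ι p ≃ ι q → p ≈ q
ι-injective {p} {q} eq = trans (sym (R.*-identityʳ p)) (trans (cross eq) (R.*-identityʳ q))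

ι-+ : ∀ p q → ι (p + q) ≃ ι p ⊞ ι q
ι-+ p q = uncross (solve 2 (λ p q → (p :+ q) :* (con 1ℚ :* con 1ℚ)
  := (p :* con 1ℚ :+ q :* con 1ℚ) :* con 1ℚ) refl p q)
  where
  open S

ι-* : ∀ p q → ι (p * q) ≃ ι p ⊠ ι q
ι-* p q = uncross (solve 2 (λ p q → p :* q :* (con 1ℚ :* con 1ℚ) := p :* q :* con 1ℚ) refl p q)
  where
  open S

ℚ⟶ℚ⟨X₄⟩ : ℚ.+-*-rawRing -Raw-AlmostCommutative⟶ fromCommutativeRing ℚ⟨X₄⟩
ℚ⟶ℚ⟨X₄⟩ = record
  { ⟦_⟧ = ι ∘ con
  ; +-homo = λ a b → ≃-trans (ι-cong (con-+ a b)) (ι-+ (con a) (con b))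
  ; *-homo = λ a b → ≃-trans (ι-cong (con-* a b)) (ι-* (con a) (con b))
  ; -‿homo = λ a → ι-cong (con-neg a) ; 0-homo = ≃-refl ; 1-homo = ≃-refl }

ιcon≟ : ∀ a b → Maybe (ι (con a) ≃ ι (con b))
ιcon≟ a b with a ℚₚ.≟ b
... | yes eq = just (K.reflexive (≡.cong (ι ∘ con) eq))
... | no _   = nothing

module T = Algebra.Solver.Ring ℚ.+-*-rawRing (fromCommutativeRing ℚ⟨X₄⟩) ℚ⟶ℚ⟨X₄⟩ ιcon≟

Invertible : RationalFunction → Set
Invertible x = Dense (num x)

invertible-resp : ∀ {x y} → x ≃ y → Invertible x → Invertible y
invertible-resp {x} {y} eq inv =
  dense-factorˡ (num y) (dense-resp (cross eq) (dense-* inv (den-dense y)))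

≃0⇒num≈0 : ∀ {x} → x ≃ ι 0# → num x ≈ 0#
≃0⇒num≈0 {x} eq = trans (sym (R.*-identityʳ _)) (trans (cross eq) (R.zeroˡ _))

num≈0⇒≃0 : ∀ {x} → num x ≈ 0# → x ≃ ι 0#
num≈0⇒≃0 {x} eq = uncross (trans (*-cong eq refl) (trans (R.zeroˡ _) (sym (R.zeroˡ _))))

⊠-cancelˡ-0 : ∀ {x y} → Invertible x → x ⊠ y ≃ ι 0# → y ≃ ι 0#
⊠-cancelˡ-0 inv eq = num≈0⇒≃0 (inv _ (≃0⇒num≈0 eq))

⊠-cancelʳ : ∀ {x} y z → Invertible x → y ⊠ x ≃ z ⊠ x → y ≃ z
⊠-cancelʳ {x} y z inv eq = ≃-trans (Kₚ.+-inverseˡ-unique y (⊟ z) (⊠-cancelˡ-0 inv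
  (≃-trans (solve 3 (λ x y z → x :* (y :- z) := y :* x :- z :* x) ≃-refl x y z)
  (≃-trans (⊞-cong eq ≃-refl) (K.-‿inverseʳ (z ⊠ x)))))) (Kₚ.-‿involutive z)
  where
  open T

num-den : ∀ x → x ⊠ ι (den x) ≃ ι (num x)
num-den (frac n d _) = uncross (solve 2 (λ n d → n :* d :* con 1ℚ := n :* (d :* con 1ℚ)) refl n d)
  where
  open S

quotient : ∀ x y → Dense (num y) → RationalFunction
quotient x y inv = frac (num x * den y) (den x * num y) (dense-* (den-dense x) inv)

quotient-⊠ : ∀ x y inv → quotient x y inv ⊠ y ≃ x
quotient-⊠ (frac n₁ d₁ _) (frac n₂ d₂ _) _ = uncross (solve 4
  (λ n₁ d₁ n₂ d₂ → n₁ :* d₂ :* n₂ :* d₁ := n₁ :* (d₁ :* n₂ :* d₂)) refl n₁ d₁ n₂ d₂)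
  where
  open S

-- Substitution of rational functions for the coordinates.

infix 9 _⟨_⟩

_⟨_⟩ : Poly → (Fin 4 → RationalFunction) → RationalFunction
con a   ⟨ f ⟩ = ι (con a)
var i   ⟨ f ⟩ = f i
(p + q) ⟨ f ⟩ = p ⟨ f ⟩ ⊞ q ⟨ f ⟩
(p * q) ⟨ f ⟩ = p ⟨ f ⟩ ⊠ q ⟨ f ⟩
(- p)   ⟨ f ⟩ = ⊟ (p ⟨ f ⟩)

-- f = (f₁,…,f₄) is a dominant rational map X₄ ⇢ X₄: its values satisfy the
-- equations of X₄, and preimages of dense open sets are dense.

record DominantMap : Set where
  field
    coord    : Fin 4 → RationalFunction
    onX₄     : ∀ i → equation i ⟨ coord ⟩ ≃ ι 0#
    dominant : ∀ h → Dense h → Dense (num (h ⟨ coord ⟩))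

open DominantMap

infix 4 _≋_

_≋_ : DominantMap → DominantMap → Set
f ≋ g = ∀ i → coord f i ≃ coord g i

-- The composite x ∘ f.

pullback : DominantMap → RationalFunction → RationalFunction
pullback f x = quotient (num x ⟨ coord f ⟩) (den x ⟨ coord f ⟩) (dominant f (den x) (den-dense x))

⟨⟩-cong : ∀ {f g : Fin 4 → RationalFunction} → (∀ i → f i ≃ g i) → ∀ p → p ⟨ f ⟩ ≃ p ⟨ g ⟩
⟨⟩-cong eq (con a) = ≃-refl
⟨⟩-cong eq (var i) = eq i
⟨⟩-cong eq (p + q) = ⊞-cong (⟨⟩-cong eq p) (⟨⟩-cong eq q)
⟨⟩-cong eq (p * q) = ⊠-cong (⟨⟩-cong eq p) (⟨⟩-cong eq q)
⟨⟩-cong eq (- p)   = ⊟-cong (⟨⟩-cong eq p)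

⟨⟩-resp : ∀ {f} → (∀ i → equation i ⟨ f ⟩ ≃ ι 0#) → ∀ {p q} → p ≈ q → p ⟨ f ⟩ ≃ q ⟨ f ⟩
⟨⟩-resp f∈ refl = ≃-refl
⟨⟩-resp f∈ (sym eq) = ≃-sym (⟨⟩-resp f∈ eq)
⟨⟩-resp f∈ (trans eq eq′) = ≃-trans (⟨⟩-resp f∈ eq) (⟨⟩-resp f∈ eq′)
⟨⟩-resp f∈ (+-cong eq eq′) = ⊞-cong (⟨⟩-resp f∈ eq) (⟨⟩-resp f∈ eq′)
⟨⟩-resp f∈ (*-cong eq eq′) = ⊠-cong (⟨⟩-resp f∈ eq) (⟨⟩-resp f∈ eq′)
⟨⟩-resp f∈ (-‿cong eq) = ⊟-cong (⟨⟩-resp f∈ eq)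
⟨⟩-resp f∈ (+-assoc p q r) = ⊞-assoc _ _ _
⟨⟩-resp f∈ (+-comm p q) = ⊞-comm _ _
⟨⟩-resp f∈ (+-identityˡ p) = ⊞-identityˡ _
⟨⟩-resp f∈ (-‿inverseˡ p) = ⊟-inverseˡ _
⟨⟩-resp f∈ (*-assoc p q r) = ⊠-assoc _ _ _
⟨⟩-resp f∈ (*-comm p q) = ⊠-comm _ _
⟨⟩-resp f∈ (*-identityˡ p) = ⊠-identityˡ _
⟨⟩-resp f∈ (distribˡ p q r) = ⊠-distribˡ _ _ _
⟨⟩-resp f∈ (con-+ a b) = ≃-trans (ι-cong (con-+ a b)) (ι-+ (con a) (con b))
⟨⟩-resp f∈ (con-* a b) = ≃-trans (ι-cong (con-* a b)) (ι-* (con a) (con b))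
⟨⟩-resp f∈ (equation≈0 i) = f∈ i

pullback-⊠ : ∀ f x → pullback f x ⊠ den x ⟨ coord f ⟩ ≃ num x ⟨ coord f ⟩
pullback-⊠ f x = quotient-⊠ (num x ⟨ coord f ⟩) (den x ⟨ coord f ⟩) _

pullback-unique : ∀ f x y → y ⊠ den x ⟨ coord f ⟩ ≃ num x ⟨ coord f ⟩ → y ≃ pullback f x
pullback-unique f x y eq = ⊠-cancelʳ y (pullback f x) (dominant f (den x) (den-dense x))
  (≃-trans eq (≃-sym (pullback-⊠ f x)))

pullback-invertible : ∀ f x → Invertible x → Invertible (pullback f x)
pullback-invertible f x inv = dense-* (dominant f (num x) inv) (den-dense (den x ⟨ coord f ⟩))

pullback-ι : ∀ f p → pullback f (ι p) ≃ p ⟨ coord f ⟩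
pullback-ι f p = ≃-sym (pullback-unique f (ι p) (p ⟨ coord f ⟩) (K.*-identityʳ _))

pullback-cong : ∀ f {x y} → x ≃ y → pullback f x ≃ pullback f y
pullback-cong f {x} {y} eq = pullback-unique f y (pullback f x)
  (⊠-cancelʳ _ _ (dominant f (den x) (den-dense x)) (begin
    pullback f x ⊠ den y ⟨ coord f ⟩ ⊠ den x ⟨ coord f ⟩
      ≈⟨ solve 3 (λ x y z → x :* y :* z := x :* z :* y) ≃-refl _ _ _ ⟩
    pullback f x ⊠ den x ⟨ coord f ⟩ ⊠ den y ⟨ coord f ⟩
      ≈⟨ ⊠-cong (pullback-⊠ f x) ≃-refl ⟩
    num x ⟨ coord f ⟩ ⊠ den y ⟨ coord f ⟩
      ≈⟨ ⟨⟩-resp (onX₄ f) (cross eq) ⟩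
    num y ⟨ coord f ⟩ ⊠ den x ⟨ coord f ⟩ ∎))
  where
  open ≃-Reasoning
  open T

pullback-⊞ : ∀ f x y → pullback f (x ⊞ y) ≃ pullback f x ⊞ pullback f y
pullback-⊞ f x y = ≃-sym (pullback-unique f (x ⊞ y) _ (begin
  (X ⊞ Y) ⊠ (dx ⊠ dy)         ≈⟨ solve 4 (λ X Y dx dy → (X :+ Y) :* (dx :* dy) := X :* dx :* dy :+ Y :* dy :* dx) ≃-refl X Y dx dy ⟩
  X ⊠ dx ⊠ dy ⊞ Y ⊠ dy ⊠ dx   ≈⟨ ⊞-cong (⊠-cong (pullback-⊠ f x) ≃-refl) (⊠-cong (pullback-⊠ f y) ≃-refl) ⟩
  num x ⟨ coord f ⟩ ⊠ dy ⊞ num y ⟨ coord f ⟩ ⊠ dx ∎))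
  where
  open ≃-Reasoning
  open T
  X = pullback f x
  Y = pullback f y
  dx = den x ⟨ coord f ⟩
  dy = den y ⟨ coord f ⟩

pullback-* : ∀ f x y → pullback f (x ⊠ y) ≃ pullback f x ⊠ pullback f y
pullback-* f x y = ≃-sym (pullback-unique f (x ⊠ y) _ (begin
  (X ⊠ Y) ⊠ (dx ⊠ dy)         ≈⟨ solve 4 (λ X Y dx dy → X :* Y :* (dx :* dy) := X :* dx :* (Y :* dy)) ≃-refl X Y dx dy ⟩
  X ⊠ dx ⊠ (Y ⊠ dy)           ≈⟨ ⊠-cong (pullback-⊠ f x) (pullback-⊠ f y) ⟩
  num x ⟨ coord f ⟩ ⊠ num y ⟨ coord f ⟩ ∎))
  where
  open ≃-Reasoning
  open T
  X = pullback f x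
  Y = pullback f y
  dx = den x ⟨ coord f ⟩
  dy = den y ⟨ coord f ⟩

pullback-⊟ : ∀ f x → pullback f (⊟ x) ≃ ⊟ pullback f x
pullback-⊟ f x = ≃-sym (pullback-unique f (⊟ x) _
  (≃-trans (≃-sym (Kₚ.-‿distribˡ-* _ _)) (⊟-cong (pullback-⊠ f x))))

pullback-⟨⟩ : ∀ g f p → pullback g (p ⟨ f ⟩) ≃ p ⟨ pullback g ∘ f ⟩
pullback-⟨⟩ g f (con a) = pullback-ι g (con a)
pullback-⟨⟩ g f (var i) = ≃-refl
pullback-⟨⟩ g f (p + q) = ≃-trans (pullback-⊞ g (p ⟨ f ⟩) (q ⟨ f ⟩)) (⊞-cong (pullback-⟨⟩ g f p) (pullback-⟨⟩ g f q))
pullback-⟨⟩ g f (p * q) = ≃-trans (pullback-* g (p ⟨ f ⟩) (q ⟨ f ⟩)) (⊠-cong (pullback-⟨⟩ g f p) (pullback-⟨⟩ g f q))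
pullback-⟨⟩ g f (- p) = ≃-trans (pullback-⊟ g (p ⟨ f ⟩)) (⊟-cong (pullback-⟨⟩ g f p))

⟨⟩-var : ∀ p → p ⟨ ι ∘ var ⟩ ≃ ι p
⟨⟩-var (con a) = ≃-refl
⟨⟩-var (var i) = ≃-refl
⟨⟩-var (p + q) = ≃-trans (⊞-cong (⟨⟩-var p) (⟨⟩-var q)) (≃-sym (ι-+ p q))
⟨⟩-var (p * q) = ≃-trans (⊠-cong (⟨⟩-var p) (⟨⟩-var q)) (≃-sym (ι-* p q))
⟨⟩-var (- p) = ⊟-cong (⟨⟩-var p)

opaque
  ∘-dominant : ∀ f g h → Dense h → Dense (num (h ⟨ pullback g ∘ coord f ⟩))
  ∘-dominant f g h dense = invertible-resp (pullback-⟨⟩ g (coord f) h)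
    (pullback-invertible g (h ⟨ coord f ⟩) (dominant f h dense))

  id-dominant : ∀ h → Dense h → Dense (num (h ⟨ ι ∘ var ⟩))
  id-dominant h dense = invertible-resp (≃-sym (⟨⟩-var h)) dense

infixr 9 _∘ᵣ_

_∘ᵣ_ : DominantMap → DominantMap → DominantMap
coord (f ∘ᵣ g) i = pullback g (coord f i)
onX₄ (f ∘ᵣ g) i = ≃-trans (≃-sym (pullback-⟨⟩ g (coord f) (equation i)))
  (≃-trans (pullback-cong g (onX₄ f i)) (pullback-ι g 0#))
dominant (f ∘ᵣ g) = ∘-dominant f g

idᵣ : DominantMap
coord idᵣ i = ι (var i)
onX₄ idᵣ i = ≃-trans (⟨⟩-var (equation i)) (ι-cong (equation≈0 i))
dominant idᵣ = id-dominant

pullback-id : ∀ x → pullback idᵣ x ≃ x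
pullback-id x = ≃-sym (pullback-unique idᵣ x x
  (≃-trans (⊠-cong (≃-refl {x}) (⟨⟩-var (den x))) (≃-trans (num-den x) (≃-sym (⟨⟩-var (num x))))))

pullback-∘ : ∀ g h x → pullback h (pullback g x) ≃ pullback (g ∘ᵣ h) x
pullback-∘ g h x = pullback-unique (g ∘ᵣ h) x _ (begin
  pullback h (pullback g x) ⊠ den x ⟨ coord (g ∘ᵣ h) ⟩
    ≈⟨ ⊠-cong ≃-refl (≃-sym (pullback-⟨⟩ h (coord g) (den x))) ⟩
  pullback h (pullback g x) ⊠ pullback h (den x ⟨ coord g ⟩)
    ≈⟨ pullback-* h (pullback g x) (den x ⟨ coord g ⟩) ⟨
  pullback h (pullback g x ⊠ den x ⟨ coord g ⟩)
    ≈⟨ pullback-cong h (pullback-⊠ g x) ⟩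
  pullback h (num x ⟨ coord g ⟩)
    ≈⟨ pullback-⟨⟩ h (coord g) (num x) ⟩
  num x ⟨ coord (g ∘ᵣ h) ⟩ ∎)
  where
  open ≃-Reasoning

pullback-≋ : ∀ {f g} → f ≋ g → ∀ x → pullback f x ≃ pullback g x
pullback-≋ {f} {g} eq x = pullback-unique g x (pullback f x)
  (≃-trans (⊠-cong ≃-refl (≃-sym (⟨⟩-cong eq (den x))))
  (≃-trans (pullback-⊠ f x) (⟨⟩-cong eq (num x))))

∘-cong : ∀ {f f′ g g′} → f ≋ f′ → g ≋ g′ → f ∘ᵣ g ≋ f′ ∘ᵣ g′
∘-cong {f′ = f′} {g} {g′} f≋f′ g≋g′ i =
  ≃-trans (pullback-cong g (f≋f′ i)) (pullback-≋ {g} {g′} g≋g′ (coord f′ i))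

∘-assoc : ∀ f g h → (f ∘ᵣ g) ∘ᵣ h ≋ f ∘ᵣ (g ∘ᵣ h)
∘-assoc f g h i = pullback-∘ g h (coord f i)

∘-identityˡ : ∀ f → idᵣ ∘ᵣ f ≋ f
∘-identityˡ f i = pullback-ι f (var i)

∘-identityʳ : ∀ f → f ∘ᵣ idᵣ ≋ f
∘-identityʳ f i = pullback-id (coord f i)

record BirationalMap : Set where
  field
    to from  : DominantMap
    to∘from  : to ∘ᵣ from ≋ idᵣ
    from∘to  : from ∘ᵣ to ≋ idᵣ

open BirationalMap

cancel-middle : ∀ {f f′ g g′} → f ∘ᵣ f′ ≋ idᵣ → g ∘ᵣ g′ ≋ idᵣ → (f ∘ᵣ g) ∘ᵣ (g′ ∘ᵣ f′) ≋ idᵣ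
cancel-middle {f} {f′} {g} {g′} ff′ gg′ i = begin
  coord ((f ∘ᵣ g) ∘ᵣ (g′ ∘ᵣ f′)) i  ≈⟨ ∘-assoc f g (g′ ∘ᵣ f′) i ⟩
  coord (f ∘ᵣ (g ∘ᵣ (g′ ∘ᵣ f′))) i  ≈⟨ pullback-≋ {g ∘ᵣ (g′ ∘ᵣ f′)} {f′} lem (coord f i) ⟩
  coord (f ∘ᵣ f′) i                 ≈⟨ ff′ i ⟩
  coord idᵣ i                       ∎
  where
  open ≃-Reasoning
  lem : g ∘ᵣ (g′ ∘ᵣ f′) ≋ f′
  lem j = ≃-trans (≃-sym (∘-assoc g g′ f′ j))
    (≃-trans (pullback-cong f′ (gg′ j)) (∘-identityˡ f′ j))

_∘ᵇ_ : BirationalMap → BirationalMap → BirationalMap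
to      (f ∘ᵇ g) = to f ∘ᵣ to g
from    (f ∘ᵇ g) = from g ∘ᵣ from f
to∘from (f ∘ᵇ g) = cancel-middle {to f} {from f} {to g} {from g} (to∘from f) (to∘from g)
from∘to (f ∘ᵇ g) = cancel-middle {from g} {to g} {from f} {to f} (from∘to g) (from∘to f)

idᵇ : BirationalMap
idᵇ = record { to = idᵣ ; from = idᵣ ; to∘from = ∘-identityˡ idᵣ ; from∘to = ∘-identityˡ idᵣ }

_⁻¹ᵇ : BirationalMap → BirationalMap
f ⁻¹ᵇ = record { to = from f ; from = to f ; to∘from = from∘to f ; from∘to = to∘from f }

from-cong : ∀ f g → to f ≋ to g → from f ≋ from g
from-cong f g eq i = begin
  coord (from f) i                         ≈⟨ ∘-identityʳ (from f) i ⟨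
  coord (from f ∘ᵣ idᵣ) i                   ≈⟨ pullback-≋ {to g ∘ᵣ from g} {idᵣ} (to∘from g) (coord (from f) i) ⟨
  coord (from f ∘ᵣ (to g ∘ᵣ from g)) i      ≈⟨ ∘-assoc (from f) (to g) (from g) i ⟨
  coord ((from f ∘ᵣ to g) ∘ᵣ from g) i      ≈⟨ pullback-cong (from g) (pullback-≋ {to f} {to g} eq (coord (from f) i)) ⟨
  coord ((from f ∘ᵣ to f) ∘ᵣ from g) i      ≈⟨ pullback-cong (from g) (from∘to f i) ⟩
  coord (idᵣ ∘ᵣ from g) i                   ≈⟨ ∘-identityˡ (from g) i ⟩
  coord (from g) i                         ∎
  where
  open ≃-Reasoning

Bir : Group 0ℓ 0ℓ
Bir = record
  { Carrier = BirationalMap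
  ; _≈_ = λ f g → to f ≋ to g
  ; _∙_ = _∘ᵇ_
  ; ε = idᵇ
  ; _⁻¹ = _⁻¹ᵇ
  ; isGroup = record
    { isMonoid = record
      { isSemigroup = record
        { isMagma = record
          { isEquivalence = record
            { refl = λ i → ≃-refl
            ; sym = λ eq i → ≃-sym (eq i)
            ; trans = λ eq eq′ i → ≃-trans (eq i) (eq′ i) }
          ; ∙-cong = λ {f} {f′} {g} {g′} → ∘-cong {to f} {to f′} {to g} {to g′} }
        ; assoc = λ f g h → ∘-assoc (to f) (to g) (to h) }
      ; identity = (λ f → ∘-identityˡ (to f)) , (λ f → ∘-identityʳ (to f)) }
    ; inverse = from∘to , to∘from
    ; ⁻¹-cong = λ {f} {g} → from-cong f g } }

-- A rational map f : X₄ ⇢ X₄ with f(f(x)) = x is dominant: if h(f(x)) vanishes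
-- on X₄, so does h(f(f(x))) = h(x).  Both hypotheses speak of the fractions
-- num (f i) / den (f i) after substitution of f.

module _ (f : Fin 4 → RationalFunction)
         (f∈X₄ : ∀ i → equation i ⟨ f ⟩ ≃ ι 0#)
         (den-inv : ∀ i → Invertible (den (f i) ⟨ f ⟩))
         (f∘f : ∀ i → num (f i) ⟨ f ⟩ ≃ ι (var i) ⊠ den (f i) ⟨ f ⟩)
         where

  private
    invertible-⊠ : ∀ {x y} → Invertible x → Invertible y → Invertible (x ⊠ y)
    invertible-⊠ = dense-*

    den-⟨f⟩-inv : ∀ p → Invertible (den (p ⟨ f ⟩) ⟨ f ⟩)
    den-⟨f⟩-inv (con a) = dense-1
    den-⟨f⟩-inv (var i) = den-inv i
    den-⟨f⟩-inv (p + q) = dense-* (den-⟨f⟩-inv p) (den-⟨f⟩-inv q)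
    den-⟨f⟩-inv (p * q) = dense-* (den-⟨f⟩-inv p) (den-⟨f⟩-inv q)
    den-⟨f⟩-inv (- p)   = den-⟨f⟩-inv p

    num-⟨f⟩ : ∀ p → num (p ⟨ f ⟩) ⟨ f ⟩ ≃ ι p ⊠ den (p ⟨ f ⟩) ⟨ f ⟩
    num-⟨f⟩ (con a) = ≃-sym (K.*-identityʳ _)
    num-⟨f⟩ (var i) = f∘f i
    num-⟨f⟩ (p + q) = begin
      n₁ ⊠ d₂ ⊞ n₂ ⊠ d₁                  ≈⟨ ⊞-cong (⊠-cong (num-⟨f⟩ p) ≃-refl) (⊠-cong (num-⟨f⟩ q) ≃-refl) ⟩
      ι p ⊠ d₁ ⊠ d₂ ⊞ ι q ⊠ d₂ ⊠ d₁      ≈⟨ solve 4 (λ p q d₁ d₂ → p :* d₁ :* d₂ :+ q :* d₂ :* d₁ := (p :+ q) :* (d₁ :* d₂)) ≃-refl (ι p) (ι q) d₁ d₂ ⟩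
      (ι p ⊞ ι q) ⊠ (d₁ ⊠ d₂)            ≈⟨ ⊠-cong (ι-+ p q) ≃-refl ⟨
      ι (p + q) ⊠ (d₁ ⊠ d₂)              ∎
      where
      open ≃-Reasoning
      open T
      n₁ = num (p ⟨ f ⟩) ⟨ f ⟩
      n₂ = num (q ⟨ f ⟩) ⟨ f ⟩
      d₁ = den (p ⟨ f ⟩) ⟨ f ⟩
      d₂ = den (q ⟨ f ⟩) ⟨ f ⟩
    num-⟨f⟩ (p * q) = begin
      n₁ ⊠ n₂                            ≈⟨ ⊠-cong (num-⟨f⟩ p) (num-⟨f⟩ q) ⟩
      ι p ⊠ d₁ ⊠ (ι q ⊠ d₂)              ≈⟨ solve 4 (λ p q d₁ d₂ → p :* d₁ :* (q :* d₂) := p :* q :* (d₁ :* d₂)) ≃-refl (ι p) (ι q) d₁ d₂ ⟩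
      ι p ⊠ ι q ⊠ (d₁ ⊠ d₂)              ≈⟨ ⊠-cong (ι-* p q) ≃-refl ⟨
      ι (p * q) ⊠ (d₁ ⊠ d₂)              ∎
      where
      open ≃-Reasoning
      open T
      n₁ = num (p ⟨ f ⟩) ⟨ f ⟩
      n₂ = num (q ⟨ f ⟩) ⟨ f ⟩
      d₁ = den (p ⟨ f ⟩) ⟨ f ⟩
      d₂ = den (q ⟨ f ⟩) ⟨ f ⟩
    num-⟨f⟩ (- p) = ≃-trans (⊟-cong (num-⟨f⟩ p)) (Kₚ.-‿distribˡ-* _ _)

    ⟨f⟩-injective : ∀ p → p ⟨ f ⟩ ≃ ι 0# → p ≈ 0#
    ⟨f⟩-injective p eq = ι-injective (⊠-cancelˡ-0 (den-⟨f⟩-inv p) (begin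
      den (p ⟨ f ⟩) ⟨ f ⟩ ⊠ ι p  ≈⟨ ⊠-comm _ _ ⟩
      ι p ⊠ den (p ⟨ f ⟩) ⟨ f ⟩  ≈⟨ num-⟨f⟩ p ⟨
      num (p ⟨ f ⟩) ⟨ f ⟩        ≈⟨ ⟨⟩-resp f∈X₄ (≃0⇒num≈0 eq) ⟩
      ι 0#                       ∎))
      where
      open ≃-Reasoning

    opaque
      f-dominant : ∀ h → Dense h → Dense (num (h ⟨ f ⟩))
      f-dominant h dense k eq = ⟨f⟩-injective k (⊠-cancelˡ-0 {num (h ⟨ f ⟩) ⟨ f ⟩} {k ⟨ f ⟩}
        (invertible-resp {ι h ⊠ den (h ⟨ f ⟩) ⟨ f ⟩} {num (h ⟨ f ⟩) ⟨ f ⟩} (≃-sym (num-⟨f⟩ h))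
          (invertible-⊠ {ι h} {den (h ⟨ f ⟩) ⟨ f ⟩} dense (den-⟨f⟩-inv h)))
        (⟨⟩-resp f∈X₄ {num (h ⟨ f ⟩) * k} {0#} eq))

    f-map : DominantMap
    f-map = record { coord = f ; onX₄ = f∈X₄ ; dominant = f-dominant }

    f∘f≋id : f-map ∘ᵣ f-map ≋ idᵣ
    f∘f≋id i = ≃-sym (pullback-unique f-map (f i) (ι (var i)) (≃-sym (f∘f i)))

  involution : BirationalMap
  involution = record { to = f-map ; from = f-map ; to∘from = f∘f≋id ; from∘to = f∘f≋id }

τ : BirationalMap
τ = involution f on (λ { i₁ → dense-1 ; i₂ → dense-1
                       ; i₃ → dense-1 ; i₄ → dense-1 }) inv
  where
  f : Fin 4 → RationalFunction
  f i₁ = ι x₄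
  f i₂ = ι x₃
  f i₃ = ι x₂
  f i₄ = ι x₁

  open T
  flip : ∀ x y z → x ⊠ x ⊞ ⊟ (ι (con (+ 2 ℚ./ 1)) ⊠ (y ⊠ y)) ⊞ z ⊠ z ⊞ ⊟ ι (con (+ 2 ℚ./ 1))
                 ≃ z ⊠ z ⊞ ⊟ (ι (con (+ 2 ℚ./ 1)) ⊠ (y ⊠ y)) ⊞ x ⊠ x ⊞ ⊟ ι (con (+ 2 ℚ./ 1))
  flip = solve 3 (λ x y z →
    x :* x :- con (+ 2 ℚ./ 1) :* (y :* y) :+ z :* z :- con (+ 2 ℚ./ 1)
    := z :* z :- con (+ 2 ℚ./ 1) :* (y :* y) :+ x :* x :- con (+ 2 ℚ./ 1)) ≃-refl

  on : ∀ i → equation i ⟨ f ⟩ ≃ ι 0#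
  on i₁ = ≃-trans (flip (ι x₁) (ι x₂) (ι x₃)) (onX₄ idᵣ i₂)
  on i₂ = ≃-trans (flip (ι x₂) (ι x₃) (ι x₄)) (onX₄ idᵣ i₁)

  inv : ∀ i → num (f i) ⟨ f ⟩ ≃ ι (var i) ⊠ den (f i) ⟨ f ⟩
  inv i₁ = ≃-sym (K.*-identityʳ _)
  inv i₂ = ≃-sym (K.*-identityʳ _)
  inv i₃ = ≃-sym (K.*-identityʳ _)
  inv i₄ = ≃-sym (K.*-identityʳ _)

μ₁₄ : BirationalMap
μ₁₄ = involution f on (λ { i₁ → dense-1 ; i₂ → dense-1
                        ; i₃ → dense-1 ; i₄ → dense-1 }) inv
  where
  f : Fin 4 → RationalFunction
  f i₁ = ι (- x₁)
  f i₂ = ι x₂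
  f i₃ = ι x₃
  f i₄ = ι (- x₄)

  open T
  on : ∀ i → equation i ⟨ f ⟩ ≃ ι 0#
  on i₁ = ≃-trans (solve 3 (λ x y z →
    :- x :* :- x :- con (+ 2 ℚ./ 1) :* (y :* y) :+ z :* z :- con (+ 2 ℚ./ 1)
    := x :* x :- con (+ 2 ℚ./ 1) :* (y :* y) :+ z :* z :- con (+ 2 ℚ./ 1)) ≃-refl (ι x₄) (ι x₃) (ι x₂))
    (onX₄ idᵣ i₁)
  on i₂ = ≃-trans (solve 3 (λ x y z →
    z :* z :- con (+ 2 ℚ./ 1) :* (y :* y) :+ :- x :* :- x :- con (+ 2 ℚ./ 1)
    := z :* z :- con (+ 2 ℚ./ 1) :* (y :* y) :+ x :* x :- con (+ 2 ℚ./ 1)) ≃-refl (ι x₁) (ι x₂) (ι x₃))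
    (onX₄ idᵣ i₂)

  inv : ∀ i → num (f i) ⟨ f ⟩ ≃ ι (var i) ⊠ den (f i) ⟨ f ⟩
  inv i₁ = ≃-trans (Kₚ.-‿involutive (ι x₁)) (≃-sym (K.*-identityʳ _))
  inv i₂ = ≃-sym (K.*-identityʳ _)
  inv i₃ = ≃-sym (K.*-identityʳ _)
  inv i₄ = ≃-trans (Kₚ.-‿involutive (ι x₄)) (≃-sym (K.*-identityʳ _))

-- With v = x₂ - x₃ and c = x₃, the ring ℚ[X₄] is free over ℚ[v,c] with basis
-- 1, x₁, x₄, x₁x₄.  It therefore acts faithfully on quadruples of power series
-- in v and c, and this is used to recognise dense open sets.

v : Poly
v = x₂ - x₃

data Poly₂ : Set where
  con     : ℚ → Poly₂
  V C     : Poly₂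
  _+_ _*_ : Poly₂ → Poly₂ → Poly₂

b₂ α δ : Poly₂
b₂ = V + C
α = con (+ 2 ℚ./ 1) + (con (+ 2 ℚ./ 1) * (b₂ * b₂) + con (ℚ.- 1ℚ) * (C * C))
δ = con (+ 2 ℚ./ 1) + (con (+ 2 ℚ./ 1) * (C * C) + con (ℚ.- 1ℚ) * (b₂ * b₂))

⌜_⌝ : Poly₂ → Poly
⌜ con a ⌝ = con a
⌜ V ⌝     = v
⌜ C ⌝     = x₃
⌜ p + q ⌝ = ⌜ p ⌝ + ⌜ q ⌝
⌜ p * q ⌝ = ⌜ p ⌝ * ⌜ q ⌝

-- The components along 1, x₁, x₄ and x₁x₄.

pattern 𝟙  = zero
pattern 𝕒  = suc zero
pattern 𝕕  = suc (suc zero)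
pattern 𝕒𝕕 = suc (suc (suc zero))

record Space : Set₁ where
  field
    Carrier       : Set
    add           : Carrier → Carrier → Carrier
    scale         : ℚ → Carrier → Carrier
    shiftV shiftC : Carrier → Carrier

module Action (𝕊 : Space) where
  open Space 𝕊

  Quad : Set
  Quad = Fin 4 → Carrier

  act : Poly₂ → Carrier → Carrier
  act (con a) s = scale a s
  act V       s = shiftV s
  act C       s = shiftC s
  act (p + q) s = add (act p s) (act q s)
  act (p * q) s = act p (act q s)

  E : Poly → Quad → Quad
  E (con a) m k = scale a (m k)
  E (var i₁) m 𝟙  = act α (m 𝕒)
  E (var i₁) m 𝕒  = m 𝟙
  E (var i₁) m 𝕕  = act α (m 𝕒𝕕)
  E (var i₁) m 𝕒𝕕 = m 𝕕
  E (var i₂) m k = act b₂ (m k)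
  E (var i₃) m k = act C (m k)
  E (var i₄) m 𝟙  = act δ (m 𝕕)
  E (var i₄) m 𝕒  = act δ (m 𝕒𝕕)
  E (var i₄) m 𝕕  = m 𝟙
  E (var i₄) m 𝕒𝕕 = m 𝕒
  E (p + q) m k = add (E p m k) (E q m k)
  E (p * q) m = E p (E q m)
  E (- p) m k = scale (ℚ.- 1ℚ) (E p m k)

-- Power series, s i j being the coefficient of vⁱcʲ, and polynomials.

series : Space
series = record
  { Carrier = ℕ → ℕ → ℚ
  ; add     = λ s t i j → s i j ℚ.+ t i j
  ; scale   = λ a s i j → a ℚ.* s i j
  ; shiftV  = λ { s zero j → 0ℚ ; s (suc i) j → s i j }
  ; shiftC  = λ { s i zero → 0ℚ ; s i (suc j) → s i j } }

addᶜ : List ℚ → List ℚ → List ℚ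
addᶜ [] bs = bs
addᶜ (a ∷ as) [] = a ∷ as
addᶜ (a ∷ as) (b ∷ bs) = (a ℚ.+ b) ∷ addᶜ as bs

addᵛ : List (List ℚ) → List (List ℚ) → List (List ℚ)
addᵛ [] ms = ms
addᵛ (l ∷ ls) [] = l ∷ ls
addᵛ (l ∷ ls) (m ∷ ms) = addᶜ l m ∷ addᵛ ls ms

lists : Space
lists = record
  { Carrier = List (List ℚ)
  ; add     = addᵛ
  ; scale   = λ a → map (map (a ℚ.*_))
  ; shiftV  = λ ls → [] ∷ ls
  ; shiftC  = map (0ℚ ∷_) }

module 𝕊 = Space series
module 𝕃 = Space lists
module AS = Action series
module AL = Action lists

infix 4 _≐_ _≐₄_

_≐_ : 𝕊.Carrier → 𝕊.Carrier → Set
s ≐ t = ∀ i j → s i j ≡ t i j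

_≐₄_ : AS.Quad → AS.Quad → Set
m ≐₄ n = ∀ k → m k ≐ n k

act-cong : ∀ p {s t} → s ≐ t → AS.act p s ≐ AS.act p t
act-cong (con a) eq i j = ≡.cong (a ℚ.*_) (eq i j)
act-cong V eq zero j = ≡.refl
act-cong V eq (suc i) j = eq i j
act-cong C eq i zero = ≡.refl
act-cong C eq i (suc j) = eq i j
act-cong (p + q) eq i j = ≡.cong₂ ℚ._+_ (act-cong p eq i j) (act-cong q eq i j)
act-cong (p * q) eq = act-cong p (act-cong q eq)

+-interchange : ∀ a b c d → (a ℚ.+ b) ℚ.+ (c ℚ.+ d) ≡ (a ℚ.+ c) ℚ.+ (b ℚ.+ d)
+-interchange = solve 4 (λ a b c d → (a :+ b) :+ (c :+ d) := (a :+ c) :+ (b :+ d)) ≡.refl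
  where
  open ℚ-Solver

act-add : ∀ p s t → AS.act p (𝕊.add s t) ≐ 𝕊.add (AS.act p s) (AS.act p t)
act-add (con a) s t i j = ℚₚ.*-distribˡ-+ a (s i j) (t i j)
act-add V s t zero j = ≡.refl
act-add V s t (suc i) j = ≡.refl
act-add C s t i zero = ≡.refl
act-add C s t i (suc j) = ≡.refl
act-add (p + q) s t i j = ≡.trans (≡.cong₂ ℚ._+_ (act-add p s t i j) (act-add q s t i j))
  (+-interchange (AS.act p s i j) _ _ _)
act-add (p * q) s t i j = ≡.trans (act-cong p (act-add q s t) i j)
  (act-add p (AS.act q s) (AS.act q t) i j)

Commute : (f g : 𝕊.Carrier → 𝕊.Carrier) → Set
Commute f g = ∀ s → f (g s) ≐ g (f s)

scale-comm : ∀ a p → Commute (𝕊.scale a) (AS.act p)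
scale-comm a (con b) s i j = solve 3 (λ a b s → a :* (b :* s) := b :* (a :* s)) ≡.refl a b (s i j)
  where
  open ℚ-Solver
scale-comm a V s zero j = ℚₚ.*-zeroʳ a
scale-comm a V s (suc i) j = ≡.refl
scale-comm a C s i zero = ℚₚ.*-zeroʳ a
scale-comm a C s i (suc j) = ≡.refl
scale-comm a (p + q) s i j = ≡.trans (ℚₚ.*-distribˡ-+ a _ _)
  (≡.cong₂ ℚ._+_ (scale-comm a p s i j) (scale-comm a q s i j))
scale-comm a (p * q) s i j = ≡.trans (scale-comm a p (AS.act q s) i j)
  (act-cong p (scale-comm a q s) i j)

shiftV-comm : ∀ p → Commute 𝕊.shiftV (AS.act p)
shiftV-comm (con a) s i j = ≡.sym (scale-comm a V s i j)
shiftV-comm V s i j = ≡.refl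
shiftV-comm C s zero zero = ≡.refl
shiftV-comm C s zero (suc j) = ≡.refl
shiftV-comm C s (suc i) zero = ≡.refl
shiftV-comm C s (suc i) (suc j) = ≡.refl
shiftV-comm (p + q) s i j = ≡.trans (act-add V (AS.act p s) (AS.act q s) i j)
  (≡.cong₂ ℚ._+_ (shiftV-comm p s i j) (shiftV-comm q s i j))
shiftV-comm (p * q) s i j = ≡.trans (shiftV-comm p (AS.act q s) i j)
  (act-cong p (shiftV-comm q s) i j)

shiftC-comm : ∀ p → Commute 𝕊.shiftC (AS.act p)
shiftC-comm (con a) s i j = ≡.sym (scale-comm a C s i j)
shiftC-comm V s i j = ≡.sym (shiftV-comm C s i j)
shiftC-comm C s i j = ≡.refl
shiftC-comm (p + q) s i j = ≡.trans (act-add C (AS.act p s) (AS.act q s) i j)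
  (≡.cong₂ ℚ._+_ (shiftC-comm p s i j) (shiftC-comm q s i j))
shiftC-comm (p * q) s i j = ≡.trans (shiftC-comm p (AS.act q s) i j)
  (act-cong p (shiftC-comm q s) i j)

act-comm : ∀ p q → Commute (AS.act p) (AS.act q)
act-comm (con a) q = scale-comm a q
act-comm V q = shiftV-comm q
act-comm C q = shiftC-comm q
act-comm (p + p′) q s i j = ≡.trans (≡.cong₂ ℚ._+_ (act-comm p q s i j) (act-comm p′ q s i j))
  (≡.sym (act-add q (AS.act p s) (AS.act p′ s) i j))
act-comm (p * p′) q s i j = ≡.trans (act-cong p (act-comm p′ q s) i j)
  (act-comm p q (AS.act p′ s) i j)

E-cong : ∀ p {m n} → m ≐₄ n → AS.E p m ≐₄ AS.E p n
E-cong (con a) eq k i j = ≡.cong (a ℚ.*_) (eq k i j)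
E-cong (var i₁) eq 𝟙 = act-cong α (eq 𝕒)
E-cong (var i₁) eq 𝕒 = eq 𝟙
E-cong (var i₁) eq 𝕕 = act-cong α (eq 𝕒𝕕)
E-cong (var i₁) eq 𝕒𝕕 = eq 𝕕
E-cong (var i₂) eq k = act-cong b₂ (eq k)
E-cong (var i₃) eq k = act-cong C (eq k)
E-cong (var i₄) eq 𝟙 = act-cong δ (eq 𝕕)
E-cong (var i₄) eq 𝕒 = act-cong δ (eq 𝕒𝕕)
E-cong (var i₄) eq 𝕕 = eq 𝟙
E-cong (var i₄) eq 𝕒𝕕 = eq 𝕒
E-cong (p + q) eq k i j = ≡.cong₂ ℚ._+_ (E-cong p eq k i j) (E-cong q eq k i j)
E-cong (p * q) eq = E-cong p (E-cong q eq)
E-cong (- p) eq k i j = ≡.cong (ℚ.- 1ℚ ℚ.*_) (E-cong p eq k i j)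

_⊹_ : AS.Quad → AS.Quad → AS.Quad
(m ⊹ n) k = 𝕊.add (m k) (n k)

E-add : ∀ p m n → AS.E p (m ⊹ n) ≐₄ (AS.E p m ⊹ AS.E p n)
E-add (con a) m n k = act-add (con a) (m k) (n k)
E-add (var i₁) m n 𝟙 = act-add α (m 𝕒) (n 𝕒)
E-add (var i₁) m n 𝕒 i j = ≡.refl
E-add (var i₁) m n 𝕕 = act-add α (m 𝕒𝕕) (n 𝕒𝕕)
E-add (var i₁) m n 𝕒𝕕 i j = ≡.refl
E-add (var i₂) m n k = act-add b₂ (m k) (n k)
E-add (var i₃) m n k = act-add C (m k) (n k)
E-add (var i₄) m n 𝟙 = act-add δ (m 𝕕) (n 𝕕)
E-add (var i₄) m n 𝕒 = act-add δ (m 𝕒𝕕) (n 𝕒𝕕)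
E-add (var i₄) m n 𝕕 i j = ≡.refl
E-add (var i₄) m n 𝕒𝕕 i j = ≡.refl
E-add (p + q) m n k i j = ≡.trans (≡.cong₂ ℚ._+_ (E-add p m n k i j) (E-add q m n k i j))
  (+-interchange (AS.E p m k i j) _ _ _)
E-add (p * q) m n k i j = ≡.trans (E-cong p (E-add q m n) k i j)
  (E-add p (AS.E q m) (AS.E q n) k i j)
E-add (- p) m n k i j = ≡.trans (≡.cong (ℚ.- 1ℚ ℚ.*_) (E-add p m n k i j))
  (ℚₚ.*-distribˡ-+ (ℚ.- 1ℚ) (AS.E p m k i j) (AS.E p n k i j))

Commute₄ : (f g : AS.Quad → AS.Quad) → Set
Commute₄ f g = ∀ m → f (g m) ≐₄ g (f m)

E-scale : ∀ p q m → AS.E q (λ k → AS.act p (m k)) ≐₄ λ k → AS.act p (AS.E q m k)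
E-scale p (con a) m k = scale-comm a p (m k)
E-scale p (var i₁) m 𝟙 = act-comm α p (m 𝕒)
E-scale p (var i₁) m 𝕒 i j = ≡.refl
E-scale p (var i₁) m 𝕕 = act-comm α p (m 𝕒𝕕)
E-scale p (var i₁) m 𝕒𝕕 i j = ≡.refl
E-scale p (var i₂) m k = act-comm b₂ p (m k)
E-scale p (var i₃) m k = act-comm C p (m k)
E-scale p (var i₄) m 𝟙 = act-comm δ p (m 𝕕)
E-scale p (var i₄) m 𝕒 = act-comm δ p (m 𝕒𝕕)
E-scale p (var i₄) m 𝕕 i j = ≡.refl
E-scale p (var i₄) m 𝕒𝕕 i j = ≡.refl
E-scale p (q + q′) m k i j = ≡.trans (≡.cong₂ ℚ._+_ (E-scale p q m k i j) (E-scale p q′ m k i j))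
  (≡.sym (act-add p (AS.E q m k) (AS.E q′ m k) i j))
E-scale p (q * q′) m k i j = ≡.trans (E-cong q (E-scale p q′ m) k i j)
  (E-scale p q (AS.E q′ m) k i j)
E-scale p (- q) m k i j = ≡.trans (≡.cong (ℚ.- 1ℚ ℚ.*_) (E-scale p q m k i j))
  (scale-comm (ℚ.- 1ℚ) p (AS.E q m k) i j)

E-comm-x₁ : ∀ q → Commute₄ (AS.E (var i₁)) (AS.E q)
E-comm-x₁ (con a) m k i j = E-scale (con a) (var i₁) m k i j
E-comm-x₁ (var i₁) m k i j = ≡.refl
E-comm-x₁ (var i₂) m k i j = E-scale b₂ (var i₁) m k i j
E-comm-x₁ (var i₃) m k i j = E-scale C (var i₁) m k i j
E-comm-x₁ (var i₄) m 𝟙 = act-comm α δ (m 𝕒𝕕)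
E-comm-x₁ (var i₄) m 𝕒 i j = ≡.refl
E-comm-x₁ (var i₄) m 𝕕 i j = ≡.refl
E-comm-x₁ (var i₄) m 𝕒𝕕 i j = ≡.refl
E-comm-x₁ (p + q) m k i j = ≡.trans (E-add (var i₁) (AS.E p m) (AS.E q m) k i j)
  (≡.cong₂ ℚ._+_ (E-comm-x₁ p m k i j) (E-comm-x₁ q m k i j))
E-comm-x₁ (p * q) m k i j = ≡.trans (E-comm-x₁ p (AS.E q m) k i j)
  (E-cong p (E-comm-x₁ q m) k i j)
E-comm-x₁ (- q) m k i j = ≡.trans (E-scale (con (ℚ.- 1ℚ)) (var i₁) (AS.E q m) k i j)
  (≡.cong (ℚ.- 1ℚ ℚ.*_) (E-comm-x₁ q m k i j))

E-comm-x₄ : ∀ q → Commute₄ (AS.E (var i₄)) (AS.E q)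
E-comm-x₄ (con a) m k i j = E-scale (con a) (var i₄) m k i j
E-comm-x₄ (var i₁) m k i j = ≡.sym (E-comm-x₁ (var i₄) m k i j)
E-comm-x₄ (var i₂) m k i j = E-scale b₂ (var i₄) m k i j
E-comm-x₄ (var i₃) m k i j = E-scale C (var i₄) m k i j
E-comm-x₄ (var i₄) m k i j = ≡.refl
E-comm-x₄ (p + q) m k i j = ≡.trans (E-add (var i₄) (AS.E p m) (AS.E q m) k i j)
  (≡.cong₂ ℚ._+_ (E-comm-x₄ p m k i j) (E-comm-x₄ q m k i j))
E-comm-x₄ (p * q) m k i j = ≡.trans (E-comm-x₄ p (AS.E q m) k i j)
  (E-cong p (E-comm-x₄ q m) k i j)
E-comm-x₄ (- q) m k i j = ≡.trans (E-scale (con (ℚ.- 1ℚ)) (var i₄) (AS.E q m) k i j)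
  (≡.cong (ℚ.- 1ℚ ℚ.*_) (E-comm-x₄ q m k i j))

E-comm : ∀ p q → Commute₄ (AS.E p) (AS.E q)
E-comm (con a) q m k i j = ≡.sym (E-scale (con a) q m k i j)
E-comm (var i₁) q = E-comm-x₁ q
E-comm (var i₂) q m k i j = ≡.sym (E-scale b₂ q m k i j)
E-comm (var i₃) q m k i j = ≡.sym (E-scale C q m k i j)
E-comm (var i₄) q = E-comm-x₄ q
E-comm (p + p′) q m k i j = ≡.trans (≡.cong₂ ℚ._+_ (E-comm p q m k i j) (E-comm p′ q m k i j))
  (≡.sym (E-add q (AS.E p m) (AS.E p′ m) k i j))
E-comm (p * p′) q m k i j = ≡.trans (E-cong p (E-comm p′ q m) k i j)
  (E-comm p q (AS.E p′ m) k i j)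
E-comm (- p) q m k i j = ≡.trans (≡.cong (ℚ.- 1ℚ ℚ.*_) (E-comm p q m k i j))
  (≡.sym (E-scale (con (ℚ.- 1ℚ)) q (AS.E p m) k i j))

E-equation : ∀ i m → AS.E (equation i) m ≐₄ AS.E 0# m
E-equation i₁ m k i j = aux k
  where
  open ℚ-Solver
  identity : ∀ s x y → ((+ 2 ℚ./ 1) ℚ.* s ℚ.+ ((+ 2 ℚ./ 1) ℚ.* x ℚ.+ ℚ.- 1ℚ ℚ.* y)
      ℚ.+ ℚ.- 1ℚ ℚ.* ((+ 2 ℚ./ 1) ℚ.* x)) ℚ.+ y ℚ.+ ℚ.- 1ℚ ℚ.* ((+ 2 ℚ./ 1) ℚ.* s) ≡ 0ℚ ℚ.* s
  identity = solve 3 (λ s x y → (con (+ 2 ℚ./ 1) :* s :+ (con (+ 2 ℚ./ 1) :* x :+ con (ℚ.- 1ℚ) :* y)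
      :+ con (ℚ.- 1ℚ) :* (con (+ 2 ℚ./ 1) :* x)) :+ y :+ con (ℚ.- 1ℚ) :* (con (+ 2 ℚ./ 1) :* s)
      := con 0ℚ :* s) ≡.refl
  aux : ∀ k → AS.E (equation i₁) m k i j ≡ AS.E 0# m k i j
  aux 𝟙 = identity (m 𝟙 i j) (AS.act (C * C) (m 𝟙) i j) (AS.act (b₂ * b₂) (m 𝟙) i j)
  aux 𝕒 = identity (m 𝕒 i j) (AS.act (C * C) (m 𝕒) i j) (AS.act (b₂ * b₂) (m 𝕒) i j)
  aux 𝕕 = identity (m 𝕕 i j) (AS.act (C * C) (m 𝕕) i j) (AS.act (b₂ * b₂) (m 𝕕) i j)
  aux 𝕒𝕕 = identity (m 𝕒𝕕 i j) (AS.act (C * C) (m 𝕒𝕕) i j) (AS.act (b₂ * b₂) (m 𝕒𝕕) i j)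
E-equation i₂ m k i j = aux k
  where
  open ℚ-Solver
  identity : ∀ s x y → y ℚ.+ ℚ.- 1ℚ ℚ.* ((+ 2 ℚ./ 1) ℚ.* x)
      ℚ.+ ((+ 2 ℚ./ 1) ℚ.* s ℚ.+ ((+ 2 ℚ./ 1) ℚ.* x ℚ.+ ℚ.- 1ℚ ℚ.* y))
      ℚ.+ ℚ.- 1ℚ ℚ.* ((+ 2 ℚ./ 1) ℚ.* s) ≡ 0ℚ ℚ.* s
  identity = solve 3 (λ s x y → y :+ con (ℚ.- 1ℚ) :* (con (+ 2 ℚ./ 1) :* x)
      :+ (con (+ 2 ℚ./ 1) :* s :+ (con (+ 2 ℚ./ 1) :* x :+ con (ℚ.- 1ℚ) :* y))
      :+ con (ℚ.- 1ℚ) :* (con (+ 2 ℚ./ 1) :* s) := con 0ℚ :* s) ≡.refl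
  aux : ∀ k → AS.E (equation i₂) m k i j ≡ AS.E 0# m k i j
  aux 𝟙 = identity (m 𝟙 i j) (AS.act (b₂ * b₂) (m 𝟙) i j) (AS.act (C * C) (m 𝟙) i j)
  aux 𝕒 = identity (m 𝕒 i j) (AS.act (b₂ * b₂) (m 𝕒) i j) (AS.act (C * C) (m 𝕒) i j)
  aux 𝕕 = identity (m 𝕕 i j) (AS.act (b₂ * b₂) (m 𝕕) i j) (AS.act (C * C) (m 𝕕) i j)
  aux 𝕒𝕕 = identity (m 𝕒𝕕 i j) (AS.act (b₂ * b₂) (m 𝕒𝕕) i j) (AS.act (C * C) (m 𝕒𝕕) i j)

E-resp : ∀ {p q} → p ≈ q → ∀ m → AS.E p m ≐₄ AS.E q m
E-resp refl m k i j = ≡.refl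
E-resp (sym eq) m k i j = ≡.sym (E-resp eq m k i j)
E-resp (trans eq eq′) m k i j = ≡.trans (E-resp eq m k i j) (E-resp eq′ m k i j)
E-resp (+-cong eq eq′) m k i j = ≡.cong₂ ℚ._+_ (E-resp eq m k i j) (E-resp eq′ m k i j)
E-resp (*-cong {p} {q} {r} {s} eq eq′) m k i j = ≡.trans (E-cong p (E-resp eq′ m) k i j)
  (E-resp eq (AS.E s m) k i j)
E-resp (-‿cong eq) m k i j = ≡.cong (ℚ.- 1ℚ ℚ.*_) (E-resp eq m k i j)
E-resp (+-assoc p q r) m k i j = ℚₚ.+-assoc (AS.E p m k i j) (AS.E q m k i j) (AS.E r m k i j)
E-resp (+-comm p q) m k i j = ℚₚ.+-comm (AS.E p m k i j) (AS.E q m k i j)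
E-resp (+-identityˡ p) m k i j =
  ≡.trans (≡.cong (ℚ._+ AS.E p m k i j) (ℚₚ.*-zeroˡ (m k i j))) (ℚₚ.+-identityˡ (AS.E p m k i j))
E-resp (-‿inverseˡ p) m k i j =
  solve 2 (λ x y → con (ℚ.- 1ℚ) :* x :+ x := con 0ℚ :* y) ≡.refl (AS.E p m k i j) (m k i j)
  where
  open ℚ-Solver
E-resp (*-assoc p q r) m k i j = ≡.refl
E-resp (*-comm p q) m = E-comm p q m
E-resp (*-identityˡ p) m k i j = ℚₚ.*-identityˡ (AS.E p m k i j)
E-resp (distribˡ p q r) m = E-add p (AS.E q m) (AS.E r m)
E-resp (con-+ a b) m k i j = ℚₚ.*-distribʳ-+ (m k i j) a b
E-resp (con-* a b) m k i j = ℚₚ.*-assoc a b (m k i j)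
E-resp (equation≈0 i) m = E-equation i m

-- The action on lists of coefficients maps to the action on power series …

coeffᶜ : List ℚ → ℕ → ℚ
coeffᶜ [] j = 0ℚ
coeffᶜ (a ∷ as) zero = a
coeffᶜ (a ∷ as) (suc j) = coeffᶜ as j

coeff : List (List ℚ) → 𝕊.Carrier
coeff [] i j = 0ℚ
coeff (l ∷ ls) zero j = coeffᶜ l j
coeff (l ∷ ls) (suc i) j = coeff ls i j

coeffᶜ-add : ∀ l m j → coeffᶜ (addᶜ l m) j ≡ coeffᶜ l j ℚ.+ coeffᶜ m j
coeffᶜ-add [] m j = ≡.sym (ℚₚ.+-identityˡ _)
coeffᶜ-add (a ∷ l) [] j = ≡.sym (ℚₚ.+-identityʳ _)
coeffᶜ-add (a ∷ l) (b ∷ m) zero = ≡.refl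
coeffᶜ-add (a ∷ l) (b ∷ m) (suc j) = coeffᶜ-add l m j

coeff-add : ∀ l m → coeff (addᵛ l m) ≐ 𝕊.add (coeff l) (coeff m)
coeff-add [] m i j = ≡.sym (ℚₚ.+-identityˡ _)
coeff-add (a ∷ l) [] i j = ≡.sym (ℚₚ.+-identityʳ _)
coeff-add (a ∷ l) (b ∷ m) zero j = coeffᶜ-add a b j
coeff-add (a ∷ l) (b ∷ m) (suc i) j = coeff-add l m i j

coeffᶜ-scale : ∀ a l j → coeffᶜ (map (a ℚ.*_) l) j ≡ a ℚ.* coeffᶜ l j
coeffᶜ-scale a [] j = ≡.sym (ℚₚ.*-zeroʳ a)
coeffᶜ-scale a (b ∷ l) zero = ≡.refl
coeffᶜ-scale a (b ∷ l) (suc j) = coeffᶜ-scale a l j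

coeff-scale : ∀ a l → coeff (𝕃.scale a l) ≐ 𝕊.scale a (coeff l)
coeff-scale a [] i j = ≡.sym (ℚₚ.*-zeroʳ a)
coeff-scale a (b ∷ l) zero j = coeffᶜ-scale a b j
coeff-scale a (b ∷ l) (suc i) j = coeff-scale a l i j

coeff-shiftC : ∀ l → coeff (𝕃.shiftC l) ≐ 𝕊.shiftC (coeff l)
coeff-shiftC [] i zero = ≡.refl
coeff-shiftC [] i (suc j) = ≡.refl
coeff-shiftC (l ∷ ls) zero zero = ≡.refl
coeff-shiftC (l ∷ ls) zero (suc j) = ≡.refl
coeff-shiftC (l ∷ ls) (suc i) zero = coeff-shiftC ls i zero
coeff-shiftC (l ∷ ls) (suc i) (suc j) = coeff-shiftC ls i (suc j)

coeff-act : ∀ p l → coeff (AL.act p l) ≐ AS.act p (coeff l)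
coeff-act (con a) l = coeff-scale a l
coeff-act V l zero j = ≡.refl
coeff-act V l (suc i) j = ≡.refl
coeff-act C l = coeff-shiftC l
coeff-act (p + q) l i j = ≡.trans (coeff-add (AL.act p l) (AL.act q l) i j)
  (≡.cong₂ ℚ._+_ (coeff-act p l i j) (coeff-act q l i j))
coeff-act (p * q) l i j = ≡.trans (coeff-act p (AL.act q l) i j) (act-cong p (coeff-act q l) i j)

coeff-E : ∀ p m → (coeff ∘ AL.E p m) ≐₄ AS.E p (coeff ∘ m)
coeff-E (con a) m k = coeff-scale a (m k)
coeff-E (var i₁) m 𝟙 = coeff-act α (m 𝕒)
coeff-E (var i₁) m 𝕒 i j = ≡.refl
coeff-E (var i₁) m 𝕕 = coeff-act α (m 𝕒𝕕)
coeff-E (var i₁) m 𝕒𝕕 i j = ≡.refl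
coeff-E (var i₂) m k = coeff-act b₂ (m k)
coeff-E (var i₃) m k = coeff-act C (m k)
coeff-E (var i₄) m 𝟙 = coeff-act δ (m 𝕕)
coeff-E (var i₄) m 𝕒 = coeff-act δ (m 𝕒𝕕)
coeff-E (var i₄) m 𝕕 i j = ≡.refl
coeff-E (var i₄) m 𝕒𝕕 i j = ≡.refl
coeff-E (p + q) m k i j = ≡.trans (coeff-add (AL.E p m k) (AL.E q m k) i j)
  (≡.cong₂ ℚ._+_ (coeff-E p m k i j) (coeff-E q m k i j))
coeff-E (p * q) m k i j = ≡.trans (coeff-E p (AL.E q m) k i j) (E-cong p (coeff-E q m) k i j)
coeff-E (- p) m k i j = ≡.trans (coeff-scale (ℚ.- 1ℚ) (AL.E p m k) i j)
  (≡.cong (ℚ.- 1ℚ ℚ.*_) (coeff-E p m k i j))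

-- … and to multiplication in ℚ[X₄].

valᶜ : List ℚ → Poly
valᶜ [] = 0#
valᶜ (a ∷ as) = con a + x₃ * valᶜ as

val : List (List ℚ) → Poly
val [] = 0#
val (l ∷ ls) = valᶜ l + v * val ls

val₄ : AL.Quad → Poly
val₄ m = val (m 𝟙) + x₁ * val (m 𝕒) + x₄ * val (m 𝕕) + x₁ * (x₄ * val (m 𝕒𝕕))

valᶜ-add : ∀ l m → valᶜ (addᶜ l m) ≈ valᶜ l + valᶜ m
valᶜ-add [] m = sym (+-identityˡ _)
valᶜ-add (a ∷ l) [] = sym (R.+-identityʳ _)
valᶜ-add (a ∷ l) (b ∷ m) = trans (+-cong (con-+ a b) (*-cong refl (valᶜ-add l m)))
  (solve 5 (λ a b x l m → (a :+ b) :+ x :* (l :+ m) := (a :+ x :* l) :+ (b :+ x :* m)) refl _ _ _ _ _)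
  where
  open S

val-add : ∀ l m → val (addᵛ l m) ≈ val l + val m
val-add [] m = sym (+-identityˡ _)
val-add (a ∷ l) [] = sym (R.+-identityʳ _)
val-add (a ∷ l) (b ∷ m) = trans (+-cong (valᶜ-add a b) (*-cong refl (val-add l m)))
  (solve 5 (λ a b x l m → (a :+ b) :+ x :* (l :+ m) := (a :+ x :* l) :+ (b :+ x :* m)) refl _ _ _ _ _)
  where
  open S

valᶜ-scale : ∀ a l → valᶜ (map (a ℚ.*_) l) ≈ con a * valᶜ l
valᶜ-scale a [] = sym (R.zeroʳ _)
valᶜ-scale a (b ∷ l) = trans (+-cong (con-* a b) (*-cong refl (valᶜ-scale a l)))
  (solve 4 (λ a b x l → a :* b :+ x :* (a :* l) := a :* (b :+ x :* l)) refl _ _ _ _)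
  where
  open S

val-scale : ∀ a l → val (𝕃.scale a l) ≈ con a * val l
val-scale a [] = sym (R.zeroʳ _)
val-scale a (b ∷ l) = trans (+-cong (valᶜ-scale a b) (*-cong refl (val-scale a l)))
  (solve 4 (λ a b x l → a :* b :+ x :* (a :* l) := a :* (b :+ x :* l)) refl _ _ _ _)
  where
  open S

val-shiftC : ∀ l → val (𝕃.shiftC l) ≈ x₃ * val l
val-shiftC [] = sym (R.zeroʳ _)
val-shiftC (l ∷ ls) = trans (+-cong (+-identityˡ _) (*-cong refl (val-shiftC ls)))
  (solve 4 (λ c l v ls → c :* l :+ v :* (c :* ls) := c :* (l :+ v :* ls)) refl _ _ _ _)
  where
  open S

val-act : ∀ p l → val (AL.act p l) ≈ ⌜ p ⌝ * val l
val-act (con a) l = val-scale a l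
val-act V l = +-identityˡ _
val-act C l = val-shiftC l
val-act (p + q) l = trans (val-add (AL.act p l) (AL.act q l))
  (trans (+-cong (val-act p l) (val-act q l)) (sym (R.distribʳ (val l) ⌜ p ⌝ ⌜ q ⌝)))
val-act (p * q) l = trans (val-act p (AL.act q l))
  (trans (*-cong refl (val-act q l)) (sym (*-assoc ⌜ p ⌝ ⌜ q ⌝ (val l))))

x₁²≈α : x₁ * x₁ ≈ ⌜ α ⌝
x₁²≈α = ≈0⇒≈ (trans (S.prove vars (reify (x₁ * x₁ - ⌜ α ⌝)) (reify (equation i₂)) refl) (equation≈0 i₂))

x₄²≈δ : x₄ * x₄ ≈ ⌜ δ ⌝
x₄²≈δ = ≈0⇒≈ (trans (S.prove vars (reify (x₄ * x₄ - ⌜ δ ⌝)) (reify (equation i₁)) refl) (equation≈0 i₁))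

componentwise : ∀ r {w x y z w′ x′ y′ z′} → w′ ≈ r * w → x′ ≈ r * x → y′ ≈ r * y → z′ ≈ r * z →
  w′ + x₁ * x′ + x₄ * y′ + x₁ * (x₄ * z′) ≈ r * (w + x₁ * x + x₄ * y + x₁ * (x₄ * z))
componentwise r eq₁ eq₂ eq₃ eq₄ = trans
  (+-cong (+-cong (+-cong eq₁ (*-cong refl eq₂)) (*-cong refl eq₃)) (*-cong refl (*-cong refl eq₄)))
  (solve 7 (λ r w x y z a d → r :* w :+ a :* (r :* x) :+ d :* (r :* y) :+ a :* (d :* (r :* z))
    := r :* (w :+ a :* x :+ d :* y :+ a :* (d :* z))) refl r _ _ _ _ x₁ x₄)
  where
  open S

val₄-E : ∀ p m → val₄ (AL.E p m) ≈ p * val₄ m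
val₄-E (con a) m = componentwise (con a) (val-scale a (m 𝟙)) (val-scale a (m 𝕒)) (val-scale a (m 𝕕)) (val-scale a (m 𝕒𝕕))
val₄-E (var i₁) m = trans
  (+-cong (+-cong (+-cong (lem 𝕒) refl) (*-cong refl (lem 𝕒𝕕))) refl)
  (solve 6 (λ w x y z a d → a :* a :* x :+ a :* w :+ d :* (a :* a :* z) :+ a :* (d :* y)
      := a :* (w :+ a :* x :+ d :* y :+ a :* (d :* z))) refl _ _ _ _ x₁ x₄)
  where
  open S
  lem : ∀ k → val (AL.act α (m k)) ≈ x₁ * x₁ * val (m k)
  lem k = trans (val-act α (m k)) (*-cong (sym x₁²≈α) refl)
val₄-E (var i₂) m = componentwise x₂ (lem 𝟙) (lem 𝕒) (lem 𝕕) (lem 𝕒𝕕)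
  where
  open S
  lem : ∀ k → val (AL.act b₂ (m k)) ≈ x₂ * val (m k)
  lem k = trans (val-act b₂ (m k)) (*-cong (solve 2 (λ b c → b :- c :+ c := b) refl x₂ x₃) refl)
val₄-E (var i₃) m = componentwise x₃ (lem 𝟙) (lem 𝕒) (lem 𝕕) (lem 𝕒𝕕)
  where
  lem : ∀ k → val (AL.act C (m k)) ≈ x₃ * val (m k)
  lem k = val-act C (m k)
val₄-E (var i₄) m = trans
  (+-cong (+-cong (+-cong (lem 𝕕) (*-cong refl (lem 𝕒𝕕))) refl) refl)
  (solve 6 (λ w x y z a d → d :* d :* y :+ a :* (d :* d :* z) :+ d :* w :+ a :* (d :* x)
      := d :* (w :+ a :* x :+ d :* y :+ a :* (d :* z))) refl _ _ _ _ x₁ x₄)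
  where
  open S
  lem : ∀ k → val (AL.act δ (m k)) ≈ x₄ * x₄ * val (m k)
  lem k = trans (val-act δ (m k)) (*-cong (sym x₄²≈δ) refl)
val₄-E (p + q) m = trans
  (+-cong (+-cong (+-cong (lem 𝟙) (*-cong refl (lem 𝕒))) (*-cong refl (lem 𝕕))) (*-cong refl (*-cong refl (lem 𝕒𝕕))))
  (trans (solve 10 (λ w x y z w′ x′ y′ z′ a d →
      w :+ w′ :+ a :* (x :+ x′) :+ d :* (y :+ y′) :+ a :* (d :* (z :+ z′))
      := w :+ a :* x :+ d :* y :+ a :* (d :* z) :+ (w′ :+ a :* x′ :+ d :* y′ :+ a :* (d :* z′)))
      refl _ _ _ _ _ _ _ _ x₁ x₄)
  (trans (+-cong (val₄-E p m) (val₄-E q m)) (sym (R.distribʳ (val₄ m) p q))))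
  where
  open S
  lem : ∀ k → val (addᵛ (AL.E p m k) (AL.E q m k)) ≈ val (AL.E p m k) + val (AL.E q m k)
  lem k = val-add (AL.E p m k) (AL.E q m k)
val₄-E (p * q) m = trans (val₄-E p (AL.E q m)) (trans (*-cong refl (val₄-E q m)) (sym (*-assoc p q (val₄ m))))
val₄-E (- p) m = trans
  (componentwise (con (ℚ.- 1ℚ)) {val (n 𝟙)} {val (n 𝕒)} {val (n 𝕕)} {val (n 𝕒𝕕)}
    (val-scale _ (n 𝟙)) (val-scale _ (n 𝕒)) (val-scale _ (n 𝕕)) (val-scale _ (n 𝕒𝕕)))
  (trans (*-cong refl (val₄-E p m))
  (solve 2 (λ p x → con (ℚ.- 1ℚ) :* (p :* x) := :- p :* x) refl p (val₄ m)))
  where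
  open S
  n = AL.E p m

valᶜ-zero : ∀ l → (∀ j → coeffᶜ l j ≡ 0ℚ) → valᶜ l ≈ 0#
valᶜ-zero [] eq = refl
valᶜ-zero (a ∷ l) eq = trans (+-cong (R.reflexive (≡.cong con (eq 0))) (*-cong refl (valᶜ-zero l (eq ∘ suc))))
  (trans (+-identityˡ _) (R.zeroʳ _))

val-zero : ∀ l → (∀ i j → coeff l i j ≡ 0ℚ) → val l ≈ 0#
val-zero [] eq = refl
val-zero (a ∷ l) eq = trans (+-cong (valᶜ-zero a (eq 0)) (*-cong refl (val-zero l (eq ∘ suc))))
  (trans (+-identityˡ _) (R.zeroʳ _))

unit : AL.Quad
unit 𝟙 = (1ℚ ∷ []) ∷ []
unit (suc _) = []

expand : Poly → AS.Quad
expand p = AS.E p (coeff ∘ unit)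

val₄-zero : ∀ m → (∀ k i j → coeff (m k) i j ≡ 0ℚ) → val₄ m ≈ 0#
val₄-zero m eq = trans
  (+-cong (+-cong (+-cong (lem 𝟙) (*-cong refl (lem 𝕒))) (*-cong refl (lem 𝕕))) (*-cong refl (*-cong refl (lem 𝕒𝕕))))
  (solve 2 (λ a d → con 0ℚ :+ a :* con 0ℚ :+ d :* con 0ℚ :+ a :* (d :* con 0ℚ) := con 0ℚ) refl x₁ x₄)
  where
  open S
  lem : ∀ k → val (m k) ≈ 0#
  lem k = val-zero (m k) (eq k)

expand-injective : ∀ p → (∀ k i j → expand p k i j ≡ 0ℚ) → p ≈ 0#
expand-injective p eq = trans (sym lem)
  (trans (sym (val₄-E p unit))
         (val₄-zero (AL.E p unit) (λ k i j → ≡.trans (coeff-E p unit k i j) (eq k i j))))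
  where
  open S
  lem : p * val₄ unit ≈ p
  lem = solve 5 (λ p a c d v → p :* (con 1ℚ :+ c :* con 0ℚ :+ v :* con 0ℚ :+ a :* con 0ℚ :+ d :* con 0ℚ :+ a :* (d :* con 0ℚ)) := p)
    refl p x₁ x₃ x₄ v

expand-0 : ∀ {p} → p ≈ 0# → ∀ k i j → expand p k i j ≡ 0ℚ
expand-0 eq k i j = ≡.trans (E-resp eq (coeff ∘ unit) k i j) (ℚₚ.*-zeroˡ ((coeff ∘ unit) k i j))

expand-v : ∀ p k → expand (v * p) k ≐ 𝕊.shiftV (expand p k)
expand-v p k i j = solve 2 (λ x y → (x :+ y) :+ con (ℚ.- 1ℚ) :* y := x) ≡.refl
  (𝕊.shiftV (expand p k) i j) (𝕊.shiftC (expand p k) i j)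
  where
  open ℚ-Solver

v-dense : Dense v
v-dense p eq = expand-injective p λ k i j →
  ≡.trans (≡.sym (expand-v p k (suc i) j)) (expand-0 eq k (suc i) j)

-- ⋂ vⁿℚ[X₄] = 0.

v-divisible⇒0 : ∀ p r → p ≈ v * (r * p) → p ≈ 0#
v-divisible⇒0 p r eq = expand-injective p λ k i j → vanish (suc i) p eq k i j (ℕₚ.n<1+n i)
  where
  vanish : ∀ n p → p ≈ v * (r * p) → ∀ k i j → i < n → expand p k i j ≡ 0ℚ
  vanish (suc n) p eq k zero j _ =
    ≡.trans (E-resp eq (coeff ∘ unit) k zero j) (expand-v (r * p) k zero j)
  vanish (suc n) p eq k (suc i) j (s≤s i<n) =
    ≡.trans (E-resp eq (coeff ∘ unit) k (suc i) j)
    (≡.trans (expand-v (r * p) k (suc i) j) (vanish n (r * p) eq′ k i j i<n))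
    where
    eq′ : r * p ≈ v * (r * (r * p))
    eq′ = trans (*-cong refl eq) (S.solve 3 (λ r v q → r S.:* (v S.:* q) S.:= v S.:* (r S.:* q)) refl r v (r * p))

1+v-dense : ∀ r → Dense (1# + v * r)
1+v-dense r p eq = v-divisible⇒0 p (- r) (≈0⇒≈ (trans
  (solve 3 (λ p v r → p :- v :* (:- r :* p) := (con 1ℚ :+ v :* r) :* p) refl p v r) eq))
  where
  open S

e f : Poly
e = x₁ - 2 · x₂ + x₃
f = x₂ - 2 · x₃ + x₄

opaque
  e-dense : Dense e
  e-dense = dense-factorˡ e (dense-resp (sym lem) (1+v-dense (- v)))
    where
    e′ : Poly
    e′ = con ℚ.½ * (x₁ + 2 · x₂ - x₃)
    lem : e * e′ ≈ 1# + v * (- v)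
    lem = ≈0⇒≈ (trans
      (S.prove vars (reify (e * e′ - (1# + v * (- v)))) (reify (con ℚ.½ * equation i₂)) refl)
      (trans (*-cong refl (equation≈0 i₂)) (R.zeroʳ _)))

  -- Up to a constant factor, the norm of 2 + ef over ℚ[v,c] is v²(1 + v(…)).

  2+ef-dense : Dense (♯ 2 + e * f)
  2+ef-dense = dense-factorˡ (♯ 2 + e * f) (dense-resp (sym norm) (dense-* (dense-* v-dense v-dense) (1+v-dense r)))
    where
    e′ f′ s r κ : Poly
    e′ = - x₁ - 2 · x₂ + x₃
    f′ = - x₄ - 2 · x₃ + x₂
    s = 2 · v ^ 2 - ♯ 2
    r = con (ℚ.- (+ 1 ℚ./ 18)) * (v ^ 5 - 8 · v ^ 3 + 22 · v + 2 · v * x₃ ^ 2 + 2 · v ^ 2 * x₃)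
    κ = con (ℚ.- (+ 1 ℚ./ 288))

    Ψ : Poly → Poly → Poly → Poly → Poly
    Ψ x y m n = (♯ 4 + x * y) ^ 2 + (♯ 4 + x * y) * (2 · m * n)
      + 4 · (y * (m ^ 2 - 2 · x) + x * (n ^ 2 - 2 · y))

    Ψ-cong : ∀ {x x′ y y′} m n → x ≈ x′ → y ≈ y′ → Ψ x y m n ≈ Ψ x′ y′ m n
    Ψ-cong {x} {x′} {y} {y′} m n eq eq′ = +-cong (+-cong (*-cong eq₁ eq₁) (*-cong eq₁ refl))
      (*-cong refl (+-cong (*-cong eq′ (+-cong refl (-‿cong (*-cong refl eq))))
                           (*-cong eq (+-cong refl (-‿cong (*-cong refl eq′))))))
      where
      eq₁ : ♯ 4 + x * y ≈ ♯ 4 + x′ * y′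
      eq₁ = +-cong refl (*-cong eq eq′)

    product : ∀ e e′ f f′ → (♯ 2 + e * f) * ((♯ 2 + e′ * f′) * ((♯ 2 + e * f′) * (♯ 2 + e′ * f)))
      ≈ Ψ (e * e′) (f * f′) (e + e′) (f + f′)
    product = solve 4 (λ e e′ f f′ →
      (k 2 :+ e :* f) :* ((k 2 :+ e′ :* f′) :* ((k 2 :+ e :* f′) :* (k 2 :+ e′ :* f)))
      := (k 4 :+ (e :* e′) :* (f :* f′)) :* (k 4 :+ (e :* e′) :* (f :* f′))
         :+ (k 4 :+ (e :* e′) :* (f :* f′)) :* (k 2 :* (e :+ e′) :* (f :+ f′))
         :+ k 4 :* ((f :* f′) :* ((e :+ e′) :* (e :+ e′) :- k 2 :* (e :* e′))
                    :+ (e :* e′) :* ((f :+ f′) :* (f :+ f′) :- k 2 :* (f :* f′)))) refl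
      where
      open S
      k : ∀ {m} → ℕ → Polynomial m
      k n = con (+ n ℚ./ 1)

    ee′ : e * e′ ≈ s
    ee′ = ≈0⇒≈ (trans
      (S.prove vars (reify (e * e′ - s)) (reify (- equation i₂)) refl)
      (trans (-‿cong (equation≈0 i₂)) Rₚ.-0#≈0#))

    ff′ : f * f′ ≈ s
    ff′ = ≈0⇒≈ (trans
      (S.prove vars (reify (f * f′ - s)) (reify (- equation i₁)) refl)
      (trans (-‿cong (equation≈0 i₁)) Rₚ.-0#≈0#))

    norm : (♯ 2 + e * f) * (((♯ 2 + e′ * f′) * ((♯ 2 + e * f′) * (♯ 2 + e′ * f))) * κ)
      ≈ v * v * (1# + v * r)
    norm = begin
      (♯ 2 + e * f) * (((♯ 2 + e′ * f′) * ((♯ 2 + e * f′) * (♯ 2 + e′ * f))) * κ)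
        ≈⟨ *-assoc _ _ _ ⟨
      (♯ 2 + e * f) * ((♯ 2 + e′ * f′) * ((♯ 2 + e * f′) * (♯ 2 + e′ * f))) * κ
        ≈⟨ *-cong (trans (product e e′ f f′) (Ψ-cong (e + e′) (f + f′) ee′ ff′)) refl ⟩
      Ψ s s (e + e′) (f + f′) * κ
        ≈⟨ S.prove vars (reify (Ψ s s (e + e′) (f + f′) * κ)) (reify (v * v * (1# + v * r))) refl ⟩
      v * v * (1# + v * r) ∎
      where
      open ≈-Reasoning

q p₁ p₂ p₃ p₄ : Poly

a b c d : Poly
a = x₁
b = x₂
c = x₃
d = x₄

q = (b - c) ^ 2 * (a - 2 · b + c)
p₁ =
      - 2 · a * b ^ 3 + a * b ^ 2 * c + 2 · a * b ^ 2 * d + 4 · a * b * c ^ 2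
      - 5 · a * b * c * d + a * b - 2 · a * c ^ 3 + 2 · a * c ^ 2 * d + a * c - a * d
      + 3 · b ^ 4 - 2 · b ^ 3 * c - 3 · b ^ 3 * d - 6 · b ^ 2 * c ^ 2 + 8 · b ^ 2 * c * d
      + b ^ 2 + 4 · b * c ^ 3 - 4 · b * c ^ 2 * d - 5 · b * c + b * d + c ^ 2 + c * d - ♯ 2
p₂ =
      - 2 · a * b ^ 2 * c + 5 · a * b * c ^ 2 - 2 · a * b * c * d + 2 · a * b
      - 2 · a * c ^ 3 + a * c ^ 2 * d - a * d + 3 · b ^ 3 * c - 8 · b ^ 2 * c ^ 2
      + 3 · b ^ 2 * c * d - 2 · b ^ 2 + 4 · b * c ^ 3 - 2 · b * c ^ 2 * d - b * c
      + 2 · b * d - ♯ 2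
p₃ =
      - 2 · a * b ^ 3 + 5 · a * b ^ 2 * c - 2 · a * b ^ 2 * d - 2 · a * b * c ^ 2
      + a * b * c * d + 3 · a * b - a * c - a * d + 3 · b ^ 4 - 8 · b ^ 3 * c
      + 3 · b ^ 3 * d + 4 · b ^ 2 * c ^ 2 - 2 · b ^ 2 * c * d - 3 · b ^ 2 - b * c
      + 3 · b * d + c ^ 2 - c * d - ♯ 2
p₄ =
      - 3 · a * b ^ 3 + 8 · a * b ^ 2 * c - 3 · a * b ^ 2 * d - 4 · a * b * c ^ 2
      + 2 · a * b * c * d + 4 · a * b - 2 · a * c - a * d + 4 · b ^ 4 - 10 · b ^ 3 * c
      + 4 · b ^ 3 * d + 2 · b ^ 2 * c ^ 2 - 2 · b ^ 2 * c * d - 4 · b ^ 2 + 5 · b * c ^ 3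
      - 2 · b * c ^ 2 * d - b * c + 4 · b * d - 2 · c ^ 4 + c ^ 3 * d + 2 · c ^ 2
      - 2 · c * d - ♯ 2

q-dense : Dense q
q-dense = dense-* (dense-* v-dense v-dense) e-dense

φ-coord : Fin 4 → RationalFunction
φ-coord i₁ = frac p₁ q q-dense
φ-coord i₂ = frac p₂ q q-dense
φ-coord i₃ = frac p₃ q q-dense
φ-coord i₄ = frac p₄ q q-dense

-- In terms of e, f and v, which generate the function field of X₄, φ is the
-- deck transformation (e,f,v) ↦ (e,f,w), with w = - (2 + ef) / 2v, of the double
-- cover (e,f) : X₄ → 𝔸².  The formulas below are those of p₁, …, p₄ and q.

module Formulas {A : Set} (_+_ _*_ : A → A → A) (-_ : A → A) (κ : ℚ → A) (v e f : A) where
  g s₁ s₂ s₃ s₄ t q′ : A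
  g = κ (+ 2 ℚ./ 1) + (e * f)
  q′ = (v * v) * e
  t = - (κ ℚ.½ * ((g * v) * e))
  s₂ = (((v * v) + (- (κ (+ 1 ℚ./ 4) * (g * g)))) + (- (κ ℚ.½ * ((v * v) * (e * e)))))
       + (κ ℚ.½ * ((v * e) * g))
  s₃ = s₂ + (- t)
  s₁ = ((e * q′) + (κ (+ 2 ℚ./ 1) * s₂)) + (- s₃)
  s₄ = ((f * q′) + (- s₂)) + (κ (+ 2 ℚ./ 1) * s₃)

module FA = Formulas _+_ _*_ -_ con
module FK = Formulas _⊞_ _⊠_ ⊟_ (ι ∘ con)
module FS {n} = Formulas (S._:+_ {n}) S._:*_ S.:-_ S.con

combination≈0 : ∀ u w → u * equation i₁ + w * equation i₂ ≈ 0#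
combination≈0 u w = trans (+-cong (*-cong refl (equation≈0 i₁)) (*-cong refl (equation≈0 i₂)))
  (S.solve 2 (λ u w → u S.:* S.con 0ℚ S.:+ w S.:* S.con 0ℚ S.:= S.con 0ℚ) refl u w)

opaque
  p₁≈s₁ : p₁ ≈ FA.s₁ v e f
  p₁≈s₁ = ≈0⇒≈ (trans (S.prove vars (reify (p₁ - FA.s₁ v e f))
    (reify (con (+ 1 ℚ./ 4) * (e * e) * equation i₁ +
      (con ℚ.½ - c * d + c * c + con ℚ.½ * (b * d - b * b)) * equation i₂)) refl) (combination≈0 _ _))

  p₂≈s₂ : p₂ ≈ FA.s₂ v e f
  p₂≈s₂ = ≈0⇒≈ (trans (S.prove vars (reify (p₂ - FA.s₂ v e f))
    (reify (con (+ 1 ℚ./ 4) * (e * e) * equation i₁ +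
      (con ℚ.½ - con ℚ.½ * (c * d) + c * c - con ℚ.½ * (b * c)) * equation i₂)) refl) (combination≈0 _ _))

  p₃≈s₃ : p₃ ≈ FA.s₃ v e f
  p₃≈s₃ = ≈0⇒≈ (trans (S.prove vars (reify (p₃ - FA.s₃ v e f))
    (reify (con (+ 1 ℚ./ 4) * (e * e) * equation i₁ +
      (con ℚ.½ - con ℚ.½ * (b * d) + b * c - con ℚ.½ * (b * b)) * equation i₂)) refl) (combination≈0 _ _))

  p₄≈s₄ : p₄ ≈ FA.s₄ v e f
  p₄≈s₄ = ≈0⇒≈ (trans (S.prove vars (reify (p₄ - FA.s₄ v e f))
    (reify (con (+ 1 ℚ./ 4) * (e * e) * equation i₁ +
      (con ℚ.½ + con ℚ.½ * (c * d) - c * c - b * d + con (+ 5 ℚ./ 2) * (b * c) - b * b) * equation i₂)) refl)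
      (combination≈0 _ _))

clear-denominators : ∀ x y z q D → x * x - 2 · (y * y) + z * z - 2 · (q * q) ≈ 0# →
  frac x q D ⊠ frac x q D ⊞ ⊟ (ι (♯ 2) ⊠ (frac y q D ⊠ frac y q D)) ⊞ frac z q D ⊠ frac z q D ⊞ ⊟ ι (♯ 2)
  ≃ ι 0#
clear-denominators x y z q D eq = num≈0⇒≃0 (trans
  (solve 4 (λ x y z q →
    (((x :* x) :* (con 1ℚ :* (q :* q)) :+ (:- (con (+ 2 ℚ./ 1) :* (y :* y))) :* (q :* q)) :* (q :* q)
      :+ (z :* z) :* ((q :* q) :* (con 1ℚ :* (q :* q)))) :* con 1ℚ
      :+ (:- con (+ 2 ℚ./ 1)) :* (((q :* q) :* (con 1ℚ :* (q :* q))) :* (q :* q))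
    := (q :* q :* (q :* q)) :* (x :* x :- con (+ 2 ℚ./ 1) :* (y :* y) :+ z :* z :- con (+ 2 ℚ./ 1) :* (q :* q)))
    refl x y z q)
  (trans (*-cong refl eq) (R.zeroʳ _)))
  where
  open S

opaque
  quadratic : 2 · (f - e) * (v * v) + 6 · (e * f * v) - (f - e) * (♯ 2 + e * f) ≈ 0#
  quadratic = trans (S.prove vars
    (reify (2 · (f - e) * (v * v) + 6 · (e * f * v) - (f - e) * (♯ 2 + e * f)))
    (reify (- e * equation i₁ + f * equation i₂)) refl) (combination≈0 (- e) f)

  φ-equation₁ : p₄ * p₄ - 2 · (p₃ * p₃) + p₂ * p₂ - 2 · (q * q) ≈ 0#
  φ-equation₁ = trans
    (+-cong (+-cong (+-cong (*-cong p₄≈s₄ p₄≈s₄) (-‿cong (*-cong refl (*-cong p₃≈s₃ p₃≈s₃)))) (*-cong p₂≈s₂ p₂≈s₂)) refl)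
    (trans (lem v e f) (trans (*-cong refl quadratic) (R.zeroʳ _)))
    where
    lem : ∀ v e f → let open FA v e f in
      s₄ * s₄ - 2 · (s₃ * s₃) + s₂ * s₂ - 2 · (q′ * q′)
      ≈ v * v * e * con ℚ.½ * (♯ 2 + e * f) * (2 · (f - e) * (v * v) + 6 · (e * f * v) - (f - e) * (♯ 2 + e * f))
    lem = solve 3 (λ v e f → let open FS v e f in
      s₄ :* s₄ :- con (+ 2 ℚ./ 1) :* (s₃ :* s₃) :+ s₂ :* s₂ :- con (+ 2 ℚ./ 1) :* (q′ :* q′)
      := v :* v :* e :* con ℚ.½ :* (con (+ 2 ℚ./ 1) :+ e :* f) :*
         (con (+ 2 ℚ./ 1) :* (f :- e) :* (v :* v) :+ con (+ 6 ℚ./ 1) :* (e :* f :* v) :- (f :- e) :* (con (+ 2 ℚ./ 1) :+ e :* f)))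
      refl
      where
      open S

  φ-equation₂ : p₃ * p₃ - 2 · (p₂ * p₂) + p₁ * p₁ - 2 · (q * q) ≈ 0#
  φ-equation₂ = trans
    (+-cong (+-cong (+-cong (*-cong p₃≈s₃ p₃≈s₃) (-‿cong (*-cong refl (*-cong p₂≈s₂ p₂≈s₂)))) (*-cong p₁≈s₁ p₁≈s₁)) refl)
    (lem v e f)
    where
    lem : ∀ v e f → let open FA v e f in
      s₃ * s₃ - 2 · (s₂ * s₂) + s₁ * s₁ - 2 · (q′ * q′) ≈ 0#
    lem = solve 3 (λ v e f → let open FS v e f in
      s₃ :* s₃ :- con (+ 2 ℚ./ 1) :* (s₂ :* s₂) :+ s₁ :* s₁ :- con (+ 2 ℚ./ 1) :* (q′ :* q′) := con 0ℚ)
      refl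
      where
      open S

φ-onX₄ : ∀ i → equation i ⟨ φ-coord ⟩ ≃ ι 0#
φ-onX₄ i₁ = clear-denominators p₄ p₃ p₂ q q-dense φ-equation₁
φ-onX₄ i₂ = clear-denominators p₃ p₂ p₁ q q-dense φ-equation₂

module Substitution (W : CommutativeRing 0ℓ 0ℓ)
                    (hom : ℚ.+-*-rawRing -Raw-AlmostCommutative⟶ fromCommutativeRing W) where
  private
    module W = CommutativeRing W
    module Wₚ = Algebra.Properties.Ring W.ring
    κ : ℚ → W.Carrier
    κ = _-Raw-AlmostCommutative⟶_.⟦_⟧ hom

    κ≟ : ∀ a b → Maybe (κ a W.≈ κ b)
    κ≟ a b with a ℚₚ.≟ b
    ... | yes eq = just (W.reflexive (≡.cong κ eq))
    ... | no _   = nothing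

    module SW = Algebra.Solver.Ring ℚ.+-*-rawRing (fromCommutativeRing W) hom κ≟
    module F = Formulas W._+_ W._*_ W.-_ κ
    module FW {n} = Formulas (SW._:+_ {n}) SW._:*_ SW.:-_ SW.con

  open W using () renaming (_+_ to _+ʷ_; _*_ to _*ʷ_; -_ to -ʷ_; _≈_ to _≈ʷ_)

  private
    deduce : ∀ {x y} α β {h r} → h ≈ʷ W.0# → r ≈ʷ W.0# →
      x +ʷ (-ʷ y) ≈ʷ (α *ʷ h) +ʷ (β *ʷ r) → x ≈ʷ y
    deduce {x} {y} α β h≈0 r≈0 eq = W.trans (Wₚ.+-inverseˡ-unique x (-ʷ y) (W.trans eq (W.trans
      (W.+-cong (W.*-cong W.refl h≈0) (W.*-cong W.refl r≈0))
      (W.trans (W.+-cong (W.zeroʳ α) (W.zeroʳ β)) (W.+-identityˡ W.0#)))))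
      (Wₚ.-‿involutive y)

  module _ (a b c d w : W.Carrier) where
    private
      two e′ f′ v′ : W.Carrier
      two = κ (+ 2 ℚ./ 1)
      e′ = (a +ʷ (-ʷ (two *ʷ b))) +ʷ c
      f′ = (b +ʷ (-ʷ (two *ʷ c))) +ʷ d
      v′ = b +ʷ (-ʷ c)

    module _ (h≈0 : (two +ʷ (e′ *ʷ f′)) +ʷ (two *ʷ (v′ *ʷ w)) ≈ʷ W.0#)
             (r≈0 : (((c *ʷ c) +ʷ (-ʷ (two *ʷ (b *ʷ b)))) +ʷ (a *ʷ a)) +ʷ (-ʷ two) ≈ʷ W.0#) where

      private
        module Fw = F w e′ f′
        αʷ βʷ we/2 : W.Carrier
        αʷ = ((κ (ℚ.- (+ 1 ℚ./ 4)) *ʷ ((two +ʷ (e′ *ʷ f′)) +ʷ (two *ʷ (v′ *ʷ w)))) +ʷ (v′ *ʷ w))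
            +ʷ (κ ℚ.½ *ʷ (w *ʷ e′))
        βʷ = κ (ℚ.- ℚ.½) *ʷ (w *ʷ w)
        we/2 = κ ℚ.½ *ʷ (w *ʷ e′)

      s₂≈ : Fw.s₂ ≈ʷ b *ʷ Fw.q′
      s₂≈ = deduce αʷ βʷ h≈0 r≈0 (solve 5 (λ a b c d w →
        let e = a :- con (+ 2 ℚ./ 1) :* b :+ c
            f = b :- con (+ 2 ℚ./ 1) :* c :+ d
            v = b :- c
            h = con (+ 2 ℚ./ 1) :+ e :* f :+ con (+ 2 ℚ./ 1) :* (v :* w)
            r = c :* c :- con (+ 2 ℚ./ 1) :* (b :* b) :+ a :* a :- con (+ 2 ℚ./ 1)
            open FW w e f in
        s₂ :- b :* q′ := (con (ℚ.- (+ 1 ℚ./ 4)) :* h :+ v :* w :+ con ℚ.½ :* (w :* e)) :* h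
                         :+ con (ℚ.- ℚ.½) :* (w :* w) :* r) W.refl a b c d w)
        where
        open SW

      s₃≈ : Fw.s₃ ≈ʷ c *ʷ Fw.q′
      s₃≈ = W.trans (W.+-cong s₂≈ W.refl) (deduce we/2 (κ 0ℚ) h≈0 r≈0 (solve 5 (λ a b c d w →
        let e = a :- con (+ 2 ℚ./ 1) :* b :+ c
            f = b :- con (+ 2 ℚ./ 1) :* c :+ d
            v = b :- c
            h = con (+ 2 ℚ./ 1) :+ e :* f :+ con (+ 2 ℚ./ 1) :* (v :* w)
            r = c :* c :- con (+ 2 ℚ./ 1) :* (b :* b) :+ a :* a :- con (+ 2 ℚ./ 1)
            open FW w e f in
        b :* q′ :- t :- c :* q′ := con ℚ.½ :* (w :* e) :* h :+ con 0ℚ :* r) W.refl a b c d w))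
        where
        open SW

      s₁≈ : Fw.s₁ ≈ʷ a *ʷ Fw.q′
      s₁≈ = W.trans (W.+-cong (W.+-cong W.refl (W.*-cong W.refl s₂≈)) (W.-‿cong s₃≈))
        (solve 4 (λ a b c q →
          (a :- con (+ 2 ℚ./ 1) :* b :+ c) :* q :+ con (+ 2 ℚ./ 1) :* (b :* q) :- c :* q := a :* q)
          W.refl a b c Fw.q′)
        where
        open SW

      s₄≈ : Fw.s₄ ≈ʷ d *ʷ Fw.q′
      s₄≈ = W.trans (W.+-cong (W.+-cong W.refl (W.-‿cong s₂≈)) (W.*-cong W.refl s₃≈))
        (solve 4 (λ b c d q →
          (b :- con (+ 2 ℚ./ 1) :* c :+ d) :* q :- b :* q :+ con (+ 2 ℚ./ 1) :* (c :* q) := d :* q)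
          W.refl b c d Fw.q′)
        where
        open SW

module KS = Substitution ℚ⟨X₄⟩ ℚ⟶ℚ⟨X₄⟩

second-difference : ∀ {x y z q r} (D : Dense q) → x - 2 · y + z ≈ r * q →
  frac x q D ⊞ ⊟ (ι (♯ 2) ⊠ frac y q D) ⊞ frac z q D ≃ ι r
second-difference {x} {y} {z} {q} {r} D eq = uncross (trans
  (solve 4 (λ x y z q →
    ((x :* (con 1ℚ :* q) :+ (:- (con (+ 2 ℚ./ 1) :* y)) :* q) :* q :+ z :* (q :* (con 1ℚ :* q))) :* con 1ℚ
    := (x :- con (+ 2 ℚ./ 1) :* y :+ z) :* (q :* q)) refl x y z q)
  (trans (*-cong eq refl)
  (solve 2 (λ r q → r :* q :* (q :* q) := r :* (q :* (con 1ℚ :* q) :* q)) refl r q)))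
  where
  open S

w : RationalFunction
w = v ⟨ φ-coord ⟩

opaque
  e⟨φ⟩≃e : e ⟨ φ-coord ⟩ ≃ e ⟨ ι ∘ var ⟩
  e⟨φ⟩≃e = ≃-trans (second-difference q-dense lem) (≃-sym (⟨⟩-var e))
    where
    lem : p₁ - 2 · p₂ + p₃ ≈ e * q
    lem = trans (+-cong (+-cong p₁≈s₁ (-‿cong (*-cong refl p₂≈s₂))) p₃≈s₃)
      (S.solve 3 (λ v e f → let open FS v e f in
        s₁ S.:- S.con (+ 2 ℚ./ 1) S.:* s₂ S.:+ s₃ S.:= e S.:* q′) refl v e f)

  f⟨φ⟩≃f : f ⟨ φ-coord ⟩ ≃ f ⟨ ι ∘ var ⟩
  f⟨φ⟩≃f = ≃-trans (second-difference q-dense lem) (≃-sym (⟨⟩-var f))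
    where
    lem : p₂ - 2 · p₃ + p₄ ≈ f * q
    lem = trans (+-cong (+-cong p₂≈s₂ (-‿cong (*-cong refl p₃≈s₃))) p₄≈s₄)
      (S.solve 3 (λ v e f → let open FS v e f in
        s₂ S.:- S.con (+ 2 ℚ./ 1) S.:* s₃ S.:+ s₄ S.:= f S.:* q′) refl v e f)

  w≃t/q : w ≃ frac (FA.t v e f) q q-dense
  w≃t/q = uncross (trans
    (S.solve 3 (λ x y q → (x S.:* q S.:+ S.:- y S.:* q) S.:* q S.:= (x S.:- y) S.:* (q S.:* q)) refl p₂ p₃ q)
    (*-cong lem refl))
    where
    lem : p₂ - p₃ ≈ FA.t v e f
    lem = trans (+-cong p₂≈s₂ (-‿cong p₃≈s₃))
      (S.solve 3 (λ v e f → let open FS v e f in s₂ S.:- s₃ S.:= t) refl v e f)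

  w-invertible : Invertible w
  w-invertible = invertible-resp (≃-sym w≃t/q)
    (dense-resp
      (S.solve 3 (λ g v e → g S.:* v S.:* e S.:* S.con (ℚ.- ℚ.½)
         S.:= S.:- (S.con ℚ.½ S.:* (g S.:* v S.:* e))) refl (♯ 2 + e * f) v e)
      (dense-* (dense-* (dense-* 2+ef-dense v-dense) e-dense) -½-dense))
    where
    -½-dense : Dense (con (ℚ.- ℚ.½))
    -½-dense = dense-factorˡ _ (dense-resp (con-* (ℚ.- ℚ.½) (ℚ.- (+ 2 ℚ./ 1))) dense-1)

  2vw : (♯ 2 + e * f) ⟨ ι ∘ var ⟩ ⊞ ι (♯ 2) ⊠ (v ⟨ ι ∘ var ⟩ ⊠ w) ≃ ι 0#
  2vw = ≃-trans (⊞-cong (⟨⟩-var (♯ 2 + e * f)) (⊠-cong ≃-refl (⊠-cong (⟨⟩-var v) w≃t/q)))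
    (uncross (S.solve 3 (λ v e f → let open FS v e f in
      (g S.:* (S.con 1ℚ S.:* (S.con 1ℚ S.:* q′))
        S.:+ S.con (+ 2 ℚ./ 1) S.:* (v S.:* t) S.:* S.con 1ℚ) S.:* S.con 1ℚ
      S.:= S.con 0ℚ S.:* (S.con 1ℚ S.:* (S.con 1ℚ S.:* (S.con 1ℚ S.:* q′)))) refl v e f))

q-invertible : Invertible (q ⟨ φ-coord ⟩)
q-invertible = dense-* {num (w ⊠ w)} (dense-* {num w} w-invertible w-invertible)
  (invertible-resp {e ⟨ ι ∘ var ⟩} {e ⟨ φ-coord ⟩} (≃-sym e⟨φ⟩≃e)
    (invertible-resp {ι e} {e ⟨ ι ∘ var ⟩} (≃-sym (⟨⟩-var e)) e-dense))

wef wef′ : Fin 4 → RationalFunction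
wef i₁ = w
wef i₂ = e ⟨ φ-coord ⟩
wef i₃ = f ⟨ φ-coord ⟩
wef i₄ = w
wef′ i₁ = w
wef′ i₂ = e ⟨ ι ∘ var ⟩
wef′ i₃ = f ⟨ ι ∘ var ⟩
wef′ i₄ = w
wef≃ : ∀ i → wef i ≃ wef′ i
wef≃ i₁ = ≃-refl
wef≃ i₂ = e⟨φ⟩≃e
wef≃ i₃ = f⟨φ⟩≃f
wef≃ i₄ = ≃-refl

φ∘φ : ∀ i → num (φ-coord i) ⟨ φ-coord ⟩ ≃ ι (var i) ⊠ den (φ-coord i) ⟨ φ-coord ⟩
φ∘φ i₁ = ≃-trans (⟨⟩-resp φ-onX₄ p₁≈s₁) (≃-trans (⟨⟩-cong wef≃ (FA.s₁ x₁ x₂ x₃))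
  (≃-trans (KS.s₁≈ (ι x₁) (ι x₂) (ι x₃) (ι x₄) w 2vw (onX₄ idᵣ i₂)) (⊠-cong (≃-refl {ι x₁}) (≃-sym (⟨⟩-cong wef≃ (FA.q′ x₁ x₂ x₃))))))
φ∘φ i₂ = ≃-trans (⟨⟩-resp φ-onX₄ p₂≈s₂) (≃-trans (⟨⟩-cong wef≃ (FA.s₂ x₁ x₂ x₃))
  (≃-trans (KS.s₂≈ (ι x₁) (ι x₂) (ι x₃) (ι x₄) w 2vw (onX₄ idᵣ i₂)) (⊠-cong (≃-refl {ι x₂}) (≃-sym (⟨⟩-cong wef≃ (FA.q′ x₁ x₂ x₃))))))
φ∘φ i₃ = ≃-trans (⟨⟩-resp φ-onX₄ p₃≈s₃) (≃-trans (⟨⟩-cong wef≃ (FA.s₃ x₁ x₂ x₃))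
  (≃-trans (KS.s₃≈ (ι x₁) (ι x₂) (ι x₃) (ι x₄) w 2vw (onX₄ idᵣ i₂)) (⊠-cong (≃-refl {ι x₃}) (≃-sym (⟨⟩-cong wef≃ (FA.q′ x₁ x₂ x₃))))))
φ∘φ i₄ = ≃-trans (⟨⟩-resp φ-onX₄ p₄≈s₄) (≃-trans (⟨⟩-cong wef≃ (FA.s₄ x₁ x₂ x₃))
  (≃-trans (KS.s₄≈ (ι x₁) (ι x₂) (ι x₃) (ι x₄) w 2vw (onX₄ idᵣ i₂)) (⊠-cong (≃-refl {ι x₄}) (≃-sym (⟨⟩-cong wef≃ (FA.q′ x₁ x₂ x₃))))))

φ : BirationalMap
φ = involution φ-coord φ-onX₄ (λ { i₁ → q-invertible ; i₂ → q-invertible ; i₃ → q-invertible ; i₄ → q-invertible }) φ∘φ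

ζ : BirationalMap
ζ = φ ∙ τ ∙ μ₁₄
  where
  open Group Bir

-- n ×ᴳ g is the n-fold product g ∙ … ∙ g, in the library’s additive notation.

HasInfiniteOrder : ∀ {c ℓ} (G : Group c ℓ) → Group.Carrier G → Set ℓ
HasInfiniteOrder G g = ∀ n → .{{NonZero n}} → ¬ (n ×ᴳ g ≈ᴳ ε)
  where
  open Group G using (ε; rawMonoid) renaming (_≈_ to _≈ᴳ_)
  open RawMonoid rawMonoid using () renaming (_×_ to _×ᴳ_)

{-# OPTIONS --safe #-}
module Submission where

-- The function e/f on X₄ is ζ-invariant, so ζ acts on the conics e = tf, and it
-- does so linearly.  The conic e = 4f passes through the trivial rational point
-- (-1,-2,-3,-4).  It is parametrised by the solutions of v² = 8gv + 8g² + 1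
-- with f = 2g, and ζ becomes (g,v) ↦ (g + v, 8g + 9v).  As ζ is defined along
-- the orbit of (g,v) = (0,1), and v increases strictly there, no power of ζ is
-- the identity.

open import Defs hiding (d; v; w)
open import Algebra.Apartness.Properties.HeytingCommutativeRing using (x#0y#0→xy#0)
open import Algebra.Bundles using (Group)
open import Algebra.Definitions.RawMonoid (Group.rawMonoid Bir) using () renaming (_×_ to _×ᴳ_)
open import Algebra.Solver.Ring.AlmostCommutativeRing
  using (fromCommutativeRing; _-Raw-AlmostCommutative⟶_)
open import Data.Fin.Base using (Fin)
open import Data.Integer.Base using (+_)
open import Data.Nat.Base using (ℕ; zero; suc)
open import Data.Product.Base using (_×_; _,_; proj₁; proj₂; uncurry)
open import Data.Rational.Base as ℚ using (ℚ; 0ℚ; 1ℚ; Positive; NonNegative)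
import Data.Rational.Properties as ℚₚ
open import Function.Base using (id)
open import Relation.Binary.PropositionalEquality as ≡ using (_≡_; _≢_)

open RationalFunction
open DominantMap
open BirationalMap
open Group Bir using (_∙_)
open ℚ-Solver using (solve; _:=_; _:+_; _:*_; :-_; con)

-- Nonzero rationals.

*-≢0 : ∀ {x y} → x ≢ 0ℚ → y ≢ 0ℚ → x ℚ.* y ≢ 0ℚ
*-≢0 = x#0y#0→xy#0 ℚₚ.heytingCommutativeRing

*-cancelʳ-≢0 : ∀ x y {z} → z ≢ 0ℚ → x ℚ.* z ≡ y ℚ.* z → x ≡ y
*-cancelʳ-≢0 x y {z} z≢0 eq = begin
  x                        ≡⟨ undo x ⟩
  x ℚ.* z ℚ.* (ℚ.1/ z)     ≡⟨ ≡.cong (ℚ._* (ℚ.1/ z)) eq ⟩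
  y ℚ.* z ℚ.* (ℚ.1/ z)     ≡⟨ undo y ⟨
  y                        ∎
  where
  open ≡.≡-Reasoning
  instance
    z-nonZero = ℚ.≢-nonZero z≢0
  undo : ∀ u → u ≡ u ℚ.* z ℚ.* (ℚ.1/ z)
  undo u = ≡.sym (≡.trans (ℚₚ.*-assoc u z (ℚ.1/ z))
    (≡.trans (≡.cong (u ℚ.*_) (ℚₚ.*-inverseʳ z)) (ℚₚ.*-identityʳ u)))

-- Evaluation of polynomials and the parametrised conic.

-- A is ℚ or, so that the ring solver can see through these definitions, its
-- type of polynomials.

module Generic {A : Set} (_⊕_ _⊗_ : A → A → A) (⊝_ : A → A) (κ : ℚ → A) where

  ⟦_⟧ : Poly → (Fin 4 → A) → A
  ⟦ con a ⟧ X = κ a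
  ⟦ var i ⟧ X = X i
  ⟦ p + q ⟧ X = ⟦ p ⟧ X ⊕ ⟦ q ⟧ X
  ⟦ p * q ⟧ X = ⟦ p ⟧ X ⊗ ⟦ q ⟧ X
  ⟦ - p ⟧   X = ⊝ ⟦ p ⟧ X

  μ₁₄ᵖ τᵖ : (Fin 4 → A) → (Fin 4 → A)
  μ₁₄ᵖ X i₁ = ⊝ X i₁
  μ₁₄ᵖ X i₂ = X i₂
  μ₁₄ᵖ X i₃ = X i₃
  μ₁₄ᵖ X i₄ = ⊝ X i₄
  τᵖ X i₁ = X i₄
  τᵖ X i₂ = X i₃
  τᵖ X i₃ = X i₂
  τᵖ X i₄ = X i₁

  -- At conicPoint g v, e = 8g, f = 2g and x₂ - x₃ = v.

  conicPoint : A → A → Fin 4 → A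
  conicPoint g v i₁ = (κ (+ 3 ℚ./ 1) ⊗ g) ⊕ (⊝ v)
  conicPoint g v i₂ = ⊝ ((κ (+ 5 ℚ./ 1) ⊗ g) ⊕ (κ (+ 2 ℚ./ 1) ⊗ v))
  conicPoint g v i₃ = ⊝ ((κ (+ 5 ℚ./ 1) ⊗ g) ⊕ (κ (+ 3 ℚ./ 1) ⊗ v))
  conicPoint g v i₄ = ⊝ ((κ (+ 3 ℚ./ 1) ⊗ g) ⊕ (κ (+ 4 ℚ./ 1) ⊗ v))

  conic : A → A → A
  conic g v = (v ⊗ v) ⊕ (⊝ ((κ (+ 8 ℚ./ 1) ⊗ ((g ⊗ v) ⊕ (g ⊗ g))) ⊕ κ 1ℚ))

  -- `τ ∙ μ₁₄` takes `(g , v)` to `(g + v , - v)`; `φ` then keeps `g + v` and exchanges `- v` for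
  -- the other root of `conic (g + v)`, the sum of the roots being 8(g + v).
  step : A × A → A × A
  step (g , v) = g ⊕ v , (κ (+ 8 ℚ./ 1) ⊗ (g ⊕ v)) ⊕ v

open Generic ℚ._+_ ℚ._*_ ℚ.-_ id
module Symbolic {n} = Generic (_:+_ {n}) _:*_ :-_ con

-- Values of rational functions at rational points.

Point : Set
Point = Fin 4 → ℚ

OnX₄ : Point → Set
OnX₄ X = ∀ i → ⟦ equation i ⟧ X ≡ 0ℚ

⟦⟧-resp : ∀ {X} → OnX₄ X → ∀ {p q} → p ≈ q → ⟦ p ⟧ X ≡ ⟦ q ⟧ X
⟦⟧-resp X∈ refl = ≡.refl
⟦⟧-resp X∈ (sym eq) = ≡.sym (⟦⟧-resp X∈ eq)
⟦⟧-resp X∈ (trans eq eq′) = ≡.trans (⟦⟧-resp X∈ eq) (⟦⟧-resp X∈ eq′)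
⟦⟧-resp X∈ (+-cong eq eq′) = ≡.cong₂ ℚ._+_ (⟦⟧-resp X∈ eq) (⟦⟧-resp X∈ eq′)
⟦⟧-resp X∈ (*-cong eq eq′) = ≡.cong₂ ℚ._*_ (⟦⟧-resp X∈ eq) (⟦⟧-resp X∈ eq′)
⟦⟧-resp X∈ (-‿cong eq) = ≡.cong ℚ.-_ (⟦⟧-resp X∈ eq)
⟦⟧-resp {X} X∈ (+-assoc p q r) = ℚₚ.+-assoc (⟦ p ⟧ X) (⟦ q ⟧ X) (⟦ r ⟧ X)
⟦⟧-resp {X} X∈ (+-comm p q) = ℚₚ.+-comm (⟦ p ⟧ X) (⟦ q ⟧ X)
⟦⟧-resp {X} X∈ (+-identityˡ p) = ℚₚ.+-identityˡ (⟦ p ⟧ X)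
⟦⟧-resp {X} X∈ (-‿inverseˡ p) = ℚₚ.+-inverseˡ (⟦ p ⟧ X)
⟦⟧-resp {X} X∈ (*-assoc p q r) = ℚₚ.*-assoc (⟦ p ⟧ X) (⟦ q ⟧ X) (⟦ r ⟧ X)
⟦⟧-resp {X} X∈ (*-comm p q) = ℚₚ.*-comm (⟦ p ⟧ X) (⟦ q ⟧ X)
⟦⟧-resp {X} X∈ (*-identityˡ p) = ℚₚ.*-identityˡ (⟦ p ⟧ X)
⟦⟧-resp {X} X∈ (distribˡ p q r) = ℚₚ.*-distribˡ-+ (⟦ p ⟧ X) (⟦ q ⟧ X) (⟦ r ⟧ X)
⟦⟧-resp X∈ (con-+ a b) = ≡.refl
⟦⟧-resp X∈ (con-* a b) = ≡.refl
⟦⟧-resp X∈ (equation≈0 i) = X∈ i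

-- The fraction x itself, not merely an equivalent one, is defined at X, with value r.

infix 4 _at_≔_ _∶_↦_

record _at_≔_ (x : RationalFunction) (X : Point) (r : ℚ) : Set where
  constructor _,_
  field
    den≢0     : ⟦ den x ⟧ X ≢ 0ℚ
    num≡r*den : ⟦ num x ⟧ X ≡ r ℚ.* ⟦ den x ⟧ X

ι-at : ∀ p X → ι p at X ≔ ⟦ p ⟧ X
ι-at p X = ℚₚ.1≢0 , ≡.sym (ℚₚ.*-identityʳ (⟦ p ⟧ X))

-- `cross` has already cancelled the dense factor, so equivalent fractions agree at every point of
-- X₄ where both are defined.
at-unique : ∀ {X x y r s} → OnX₄ X → x ≃ y → x at X ≔ r → y at X ≔ s → r ≡ s
at-unique {X} {x} {y} {r} {s} X∈ eq (dx≢0 , nx) (dy≢0 , ny) =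
  *-cancelʳ-≢0 r s (*-≢0 dx≢0 dy≢0) (begin
    r ℚ.* (dx ℚ.* dy)     ≡⟨ ℚₚ.*-assoc r dx dy ⟨
    r ℚ.* dx ℚ.* dy       ≡⟨ ≡.cong (ℚ._* dy) nx ⟨
    ⟦ num x ⟧ X ℚ.* dy    ≡⟨ ⟦⟧-resp X∈ (cross eq) ⟩
    ⟦ num y ⟧ X ℚ.* dx    ≡⟨ ≡.cong (ℚ._* dx) ny ⟩
    s ℚ.* dy ℚ.* dx       ≡⟨ solve 3 (λ s dx dy → s :* dy :* dx := s :* (dx :* dy)) ≡.refl s dx dy ⟩
    s ℚ.* (dx ℚ.* dy)     ∎)
  where
  open ≡.≡-Reasoning
  dx = ⟦ den x ⟧ X
  dy = ⟦ den y ⟧ X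

-- Images of rational points under birational maps.

record _∶_↦_ (f : BirationalMap) (X Y : Point) : Set where
  constructor mapsto
  field
    coord-at : ∀ i → coord (to f) i at X ≔ Y i

open _∶_↦_

-- Nothing is cancelled in `p ⟨ f ⟩`: its denominator is a product of denominators of the `f i` and
-- ones, hence nonzero at `X`.
⟨⟩-at : ∀ {f : Fin 4 → RationalFunction} {X Y} → (∀ i → f i at X ≔ Y i) → ∀ p → p ⟨ f ⟩ at X ≔ ⟦ p ⟧ Y
⟨⟩-at {X = X} f↦ (con a) = ι-at (con a) X
⟨⟩-at f↦ (var i) = f↦ i
⟨⟩-at {f} {X} {Y} f↦ (p + q) with ⟨⟩-at f↦ p | ⟨⟩-at f↦ q
... | d≢0 , n | d′≢0 , n′ = *-≢0 d≢0 d′≢0 , ≡.trans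
  (≡.cong₂ ℚ._+_ (≡.cong (ℚ._* d′) n) (≡.cong (ℚ._* d) n′))
  (solve 4 (λ r s d d′ → r :* d :* d′ :+ s :* d′ :* d := (r :+ s) :* (d :* d′)) ≡.refl (⟦ p ⟧ Y) (⟦ q ⟧ Y) d d′)
  where
  d  = ⟦ den (p ⟨ f ⟩) ⟧ X
  d′ = ⟦ den (q ⟨ f ⟩) ⟧ X
⟨⟩-at {f} {X} {Y} f↦ (p * q) with ⟨⟩-at f↦ p | ⟨⟩-at f↦ q
... | d≢0 , n | d′≢0 , n′ = *-≢0 d≢0 d′≢0 , ≡.trans (≡.cong₂ ℚ._*_ n n′)
  (solve 4 (λ r s d d′ → r :* d :* (s :* d′) := r :* s :* (d :* d′)) ≡.refl (⟦ p ⟧ Y) (⟦ q ⟧ Y)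
    (⟦ den (p ⟨ f ⟩) ⟧ X) (⟦ den (q ⟨ f ⟩) ⟧ X))
⟨⟩-at {f} {X} {Y} f↦ (- p) with ⟨⟩-at f↦ p
... | d≢0 , n = d≢0 , ≡.trans (≡.cong ℚ.-_ n) (ℚₚ.neg-distribˡ-* (⟦ p ⟧ Y) (⟦ den (p ⟨ f ⟩) ⟧ X))

↦-OnX₄ : ∀ f {X Y} → OnX₄ X → f ∶ X ↦ Y → OnX₄ Y
↦-OnX₄ f {X} X∈ f↦ i = at-unique X∈ (onX₄ (to f) i) (⟨⟩-at (coord-at f↦) (equation i)) (ι-at 0# X)

-- `quotient` divides by `den x ⟨ coord (to f) ⟩`, whose value at `X` is that of `den x` at `Y`,
-- hence nonzero.
pullback-at : ∀ f x {X Y r} → f ∶ X ↦ Y → x at Y ≔ r → pullback (to f) x at X ≔ r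
pullback-at f x {X} {Y} {r} f↦ (dx≢0 , nx)
  with ⟨⟩-at (coord-at f↦) (num x) | ⟨⟩-at (coord-at f↦) (den x)
... | dN≢0 , nN | dD≢0 , nD = *-≢0 dN≢0 nD≢0 , (begin
  ⟦ num N ⟧ X ℚ.* dD                     ≡⟨ ≡.cong (ℚ._* dD) (≡.trans nN (≡.cong (ℚ._* dN) nx)) ⟩
  r ℚ.* ⟦ den x ⟧ Y ℚ.* dN ℚ.* dD        ≡⟨ solve 4 (λ r d dN dD → r :* d :* dN :* dD := r :* (dN :* (d :* dD))) ≡.refl r (⟦ den x ⟧ Y) dN dD ⟩
  r ℚ.* (dN ℚ.* (⟦ den x ⟧ Y ℚ.* dD))    ≡⟨ ≡.cong (λ u → r ℚ.* (dN ℚ.* u)) nD ⟨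
  r ℚ.* (dN ℚ.* ⟦ num D ⟧ X)             ∎)
  where
  open ≡.≡-Reasoning
  N = num x ⟨ coord (to f) ⟩
  D = den x ⟨ coord (to f) ⟩
  dN = ⟦ den N ⟧ X
  dD = ⟦ den D ⟧ X
  nD≢0 : ⟦ num D ⟧ X ≢ 0ℚ
  nD≢0 eq = *-≢0 dx≢0 dD≢0 (≡.trans (≡.sym nD) eq)

-- Lets definedness of a composite be checked one factor at a time along the orbit.
∙-↦ : ∀ f g {X Y Z} → g ∶ X ↦ Y → f ∶ Y ↦ Z → (f ∙ g) ∶ X ↦ Z
∙-↦ f g g↦ f↦ = mapsto λ i → pullback-at g (coord (to f) i) g↦ (coord-at f↦ i)

-- The maps `φ`, `μ₁₄` and `τ` on points.

ℚ⟶ℚ : ℚ.+-*-rawRing -Raw-AlmostCommutative⟶ fromCommutativeRing ℚₚ.+-*-commutativeRing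
ℚ⟶ℚ = record
  { ⟦_⟧ = id ; +-homo = λ _ _ → ≡.refl ; *-homo = λ _ _ → ≡.refl
  ; -‿homo = λ _ → ≡.refl ; 0-homo = ≡.refl ; 1-homo = ≡.refl }

module ℚS = Substitution ℚₚ.+-*-commutativeRing ℚ⟶ℚ

-- `φ` preserves `e` and `f` and sends v to w with 2 + ef + 2vw = 0. This relation is symmetric in v
-- and w, so the identities behind `φ∘φ` apply with `Y` as the base point and the v of `X` as w.
φ-↦ : ∀ X Y → OnX₄ X → ⟦ x₂ - x₃ ⟧ X ≢ 0ℚ → ⟦ e ⟧ X ≢ 0ℚ →
  ⟦ equation i₂ ⟧ Y ≡ 0ℚ → ⟦ e ⟧ X ≡ ⟦ e ⟧ Y → ⟦ f ⟧ X ≡ ⟦ f ⟧ Y →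
  (+ 2 ℚ./ 1) ℚ.+ ⟦ e ⟧ Y ℚ.* ⟦ f ⟧ Y ℚ.+ (+ 2 ℚ./ 1) ℚ.* (⟦ x₂ - x₃ ⟧ Y ℚ.* ⟦ x₂ - x₃ ⟧ X) ≡ 0ℚ →
  φ ∶ X ↦ Y
φ-↦ X Y X∈ v≢0 e≢0 Y∈ e≡ f≡ 2+ef+2vw≡0 = mapsto λ where
    i₁ → qX≢0 , value i₁ p₁≈s₁ F.s₁ ≡.refl (ℚS.s₁≈ (Y i₁) (Y i₂) (Y i₃) (Y i₄) w 2+ef+2vw≡0 Y∈)
    i₂ → qX≢0 , value i₂ p₂≈s₂ F.s₂ ≡.refl (ℚS.s₂≈ (Y i₁) (Y i₂) (Y i₃) (Y i₄) w 2+ef+2vw≡0 Y∈)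
    i₃ → qX≢0 , value i₃ p₃≈s₃ F.s₃ ≡.refl (ℚS.s₃≈ (Y i₁) (Y i₂) (Y i₃) (Y i₄) w 2+ef+2vw≡0 Y∈)
    i₄ → qX≢0 , value i₄ p₄≈s₄ F.s₄ ≡.refl (ℚS.s₄≈ (Y i₁) (Y i₂) (Y i₃) (Y i₄) w 2+ef+2vw≡0 Y∈)
  where
  module F = Formulas ℚ._+_ ℚ._*_ ℚ.-_ id
  w = ⟦ x₂ - x₃ ⟧ X
  qX≢0 : ⟦ q ⟧ X ≢ 0ℚ
  qX≢0 = *-≢0 (*-≢0 v≢0 v≢0) e≢0
  -- Separating out `S` allows `e` and `f` at `X` to be replaced by their values at `Y`.
  value : ∀ {p s} i → p ≈ s → (S : ℚ → ℚ → ℚ → ℚ) → ⟦ s ⟧ X ≡ S w (⟦ e ⟧ X) (⟦ f ⟧ X) →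
    S w (⟦ e ⟧ Y) (⟦ f ⟧ Y) ≡ Y i ℚ.* F.q′ w (⟦ e ⟧ Y) (⟦ f ⟧ Y) →
    ⟦ p ⟧ X ≡ Y i ℚ.* ⟦ q ⟧ X
  value {p} {s} i p≈s S s≡ eq = begin
    ⟦ p ⟧ X                                  ≡⟨ ⟦⟧-resp X∈ p≈s ⟩
    ⟦ s ⟧ X                                  ≡⟨ s≡ ⟩
    S w (⟦ e ⟧ X) (⟦ f ⟧ X)                  ≡⟨ ≡.cong₂ (S w) e≡ f≡ ⟩
    S w (⟦ e ⟧ Y) (⟦ f ⟧ Y)                  ≡⟨ eq ⟩
    Y i ℚ.* F.q′ w (⟦ e ⟧ Y) (⟦ f ⟧ Y)       ≡⟨ ≡.cong (λ u → Y i ℚ.* (w ℚ.* w ℚ.* u)) e≡ ⟨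
    Y i ℚ.* ⟦ q ⟧ X                          ∎
    where
    open ≡.≡-Reasoning

μ₁₄-↦ : ∀ X → μ₁₄ ∶ X ↦ μ₁₄ᵖ X
μ₁₄-↦ X = mapsto λ where
  i₁ → ι-at (- x₁) X
  i₂ → ι-at x₂ X
  i₃ → ι-at x₃ X
  i₄ → ι-at (- x₄) X

τ-↦ : ∀ X → τ ∶ X ↦ τᵖ X
τ-↦ X = mapsto λ where
  i₁ → ι-at x₄ X
  i₂ → ι-at x₃ X
  i₃ → ι-at x₂ X
  i₄ → ι-at x₁ X

-- The action of `ζ` on the conic.

conicPoint-OnX₄ : ∀ g v → conic g v ≡ 0ℚ → OnX₄ (conicPoint g v)
conicPoint-OnX₄ g v gv∈ = λ where
    i₁ → ≡.trans (equation₁ g v) 2*conic≡0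
    i₂ → ≡.trans (equation₂ g v) 2*conic≡0
  where
  open Symbolic renaming (⟦_⟧ to ⟦_⟧ˢ; conicPoint to conicPointˢ; conic to conicˢ)
  2*conic≡0 : (+ 2 ℚ./ 1) ℚ.* conic g v ≡ 0ℚ
  2*conic≡0 = ≡.trans (≡.cong ((+ 2 ℚ./ 1) ℚ.*_) gv∈) (ℚₚ.*-zeroʳ (+ 2 ℚ./ 1))
  equation₁ : ∀ g v → ⟦ equation i₁ ⟧ (conicPoint g v) ≡ (+ 2 ℚ./ 1) ℚ.* conic g v
  equation₁ = solve 2 (λ g v → ⟦ equation i₁ ⟧ˢ (conicPointˢ g v) := con (+ 2 ℚ./ 1) :* conicˢ g v) ≡.refl
  equation₂ : ∀ g v → ⟦ equation i₂ ⟧ (conicPoint g v) ≡ (+ 2 ℚ./ 1) ℚ.* conic g v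
  equation₂ = solve 2 (λ g v → ⟦ equation i₂ ⟧ˢ (conicPointˢ g v) := con (+ 2 ℚ./ 1) :* conicˢ g v) ≡.refl

-- `conic` takes equal values at (g, v) and (g + v, - v), and at (G, u) and (G, 8G - u); `step`
-- composes these two substitutions.
conic-step : ∀ g v → uncurry conic (step (g , v)) ≡ conic g v
conic-step = solve 2 (λ g v → uncurry Symbolic.conic (Symbolic.step (g , v)) := Symbolic.conic g v) ≡.refl

positive⇒≢0 : ∀ x .{{_ : Positive x}} → x ≢ 0ℚ
positive⇒≢0 x x≡0 = ℚₚ.<-irrefl (≡.sym x≡0) (ℚₚ.positive⁻¹ x)

-- This number is both the value of `e` at the point where `φ` is applied and the increment of v
-- under `step`.
8[g+v]>0 : ∀ g v → .{{NonNegative g}} → .{{Positive v}} → Positive ((+ 8 ℚ./ 1) ℚ.* (g ℚ.+ v))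
8[g+v]>0 g v = ℚₚ.pos*pos⇒pos (+ 8 ℚ./ 1) (g ℚ.+ v) {{ℚₚ.nonNeg+pos⇒pos g v}}

-- The sign conditions keep `ζ` defined: at the point reached by `τ ∙ μ₁₄`, the denominator v²e of
-- `φ` is a product of nonzero factors.
ζ-↦ : ∀ g v → conic g v ≡ 0ℚ → .{{NonNegative g}} → .{{Positive v}} →
  ζ ∶ conicPoint g v ↦ uncurry conicPoint (step (g , v))
ζ-↦ g v gv∈ = ∙-↦ (φ ∙ τ) μ₁₄ (μ₁₄-↦ X)
  (∙-↦ φ τ (τ-↦ (μ₁₄ᵖ X))
    (φ-↦ Y Z Y∈ v≢0 e≢0 (uncurry conicPoint-OnX₄ (step (g , v)) (≡.trans (conic-step g v) gv∈) i₂)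
      (≡.trans (eY≡ g v) (≡.sym (eZ≡ g v))) (f≡ g v) (≡.trans (2+ef+2vw≡ g v) -2*conic≡0)))
  where
  open Symbolic renaming (⟦_⟧ to ⟦_⟧ˢ; conicPoint to conicPointˢ; conic to conicˢ;
    step to stepˢ; μ₁₄ᵖ to μ₁₄ˢ; τᵖ to τˢ)
  X = conicPoint g v
  Y = τᵖ (μ₁₄ᵖ X)
  Z = uncurry conicPoint (step (g , v))

  Y∈ : OnX₄ Y
  Y∈ = ↦-OnX₄ τ (↦-OnX₄ μ₁₄ (conicPoint-OnX₄ g v gv∈) (μ₁₄-↦ X)) (τ-↦ (μ₁₄ᵖ X))

  vY≡ : ∀ g v → ℚ.- ⟦ x₂ - x₃ ⟧ (τᵖ (μ₁₄ᵖ (conicPoint g v))) ≡ v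
  vY≡ = solve 2 (λ g v → :- ⟦ x₂ - x₃ ⟧ˢ (τˢ (μ₁₄ˢ (conicPointˢ g v))) := v) ≡.refl

  eY≡ : ∀ g v → ⟦ e ⟧ (τᵖ (μ₁₄ᵖ (conicPoint g v))) ≡ (+ 8 ℚ./ 1) ℚ.* (g ℚ.+ v)
  eY≡ = solve 2 (λ g v → ⟦ e ⟧ˢ (τˢ (μ₁₄ˢ (conicPointˢ g v))) := con (+ 8 ℚ./ 1) :* (g :+ v)) ≡.refl

  eZ≡ : ∀ g v → ⟦ e ⟧ (uncurry conicPoint (step (g , v))) ≡ (+ 8 ℚ./ 1) ℚ.* (g ℚ.+ v)
  eZ≡ = solve 2 (λ g v → ⟦ e ⟧ˢ (uncurry conicPointˢ (stepˢ (g , v))) := con (+ 8 ℚ./ 1) :* (g :+ v)) ≡.refl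

  f≡ : ∀ g v → ⟦ f ⟧ (τᵖ (μ₁₄ᵖ (conicPoint g v))) ≡ ⟦ f ⟧ (uncurry conicPoint (step (g , v)))
  f≡ = solve 2 (λ g v → ⟦ f ⟧ˢ (τˢ (μ₁₄ˢ (conicPointˢ g v))) := ⟦ f ⟧ˢ (uncurry conicPointˢ (stepˢ (g , v)))) ≡.refl

  -- With G = g + v, ef is 16G², while the roots - v and 8G + v have product - (8G² + 1) on the
  -- conic.
  2+ef+2vw≡ : ∀ g v → let Y = τᵖ (μ₁₄ᵖ (conicPoint g v)) ; Z = uncurry conicPoint (step (g , v)) in
    (+ 2 ℚ./ 1) ℚ.+ ⟦ e ⟧ Z ℚ.* ⟦ f ⟧ Z ℚ.+ (+ 2 ℚ./ 1) ℚ.* (⟦ x₂ - x₃ ⟧ Z ℚ.* ⟦ x₂ - x₃ ⟧ Y)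
    ≡ (+ 2 ℚ./ 1) ℚ.* (ℚ.- conic g v)
  2+ef+2vw≡ = solve 2 (λ g v → let Y = τˢ (μ₁₄ˢ (conicPointˢ g v)) ; Z = uncurry conicPointˢ (stepˢ (g , v)) in
    con (+ 2 ℚ./ 1) :+ ⟦ e ⟧ˢ Z :* ⟦ f ⟧ˢ Z :+ con (+ 2 ℚ./ 1) :* (⟦ x₂ - x₃ ⟧ˢ Z :* ⟦ x₂ - x₃ ⟧ˢ Y)
    := con (+ 2 ℚ./ 1) :* (:- conicˢ g v)) ≡.refl

  -2*conic≡0 : (+ 2 ℚ./ 1) ℚ.* (ℚ.- conic g v) ≡ 0ℚ
  -2*conic≡0 = ≡.cong (λ u → (+ 2 ℚ./ 1) ℚ.* (ℚ.- u)) gv∈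

  v≢0 : ⟦ x₂ - x₃ ⟧ Y ≢ 0ℚ
  v≢0 eq = positive⇒≢0 v (≡.trans (≡.sym (vY≡ g v)) (≡.cong ℚ.-_ eq))

  e≢0 : ⟦ e ⟧ Y ≢ 0ℚ
  e≢0 eq = positive⇒≢0 _ {{8[g+v]>0 g v}} (≡.trans (≡.sym (eY≡ g v)) eq)

-- The orbit of the trivial point and infinite order.

orbit : ℕ → ℚ × ℚ
orbit zero    = 0ℚ , 1ℚ
orbit (suc n) = step (orbit n)

orbit-conic : ∀ n → uncurry conic (orbit n) ≡ 0ℚ
orbit-conic zero    = ≡.refl
orbit-conic (suc n) = ≡.trans (uncurry conic-step (orbit n)) (orbit-conic n)

orbit-positive : ∀ n → NonNegative (proj₁ (orbit n)) × Positive (proj₂ (orbit n))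
orbit-positive zero    = _ , _
orbit-positive (suc n) =
  ℚₚ.pos⇒nonNeg (g ℚ.+ v) {{ℚₚ.nonNeg+pos⇒pos g v}} ,
  ℚₚ.pos+pos⇒pos ((+ 8 ℚ./ 1) ℚ.* (g ℚ.+ v)) {{8[g+v]>0 g v}} v
  where
  g = proj₁ (orbit n)
  v = proj₂ (orbit n)
  instance
    g≥0 = proj₁ (orbit-positive n)
    v>0 = proj₂ (orbit-positive n)

orbit-increasing : ∀ n → proj₂ (orbit n) ℚ.< proj₂ (orbit (suc n))
orbit-increasing n = ≡.subst (ℚ._< proj₂ (orbit (suc n))) (ℚₚ.+-identityˡ v)
  (ℚₚ.+-monoˡ-< v (ℚₚ.positive⁻¹ ((+ 8 ℚ./ 1) ℚ.* (g ℚ.+ v)) {{8[g+v]>0 g v}}))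
  where
  g = proj₁ (orbit n)
  v = proj₂ (orbit n)
  instance
    g≥0 = proj₁ (orbit-positive n)
    v>0 = proj₂ (orbit-positive n)

orbit-≥1 : ∀ n → 1ℚ ℚ.≤ proj₂ (orbit n)
orbit-≥1 zero    = ℚₚ.≤-refl
orbit-≥1 (suc n) = ℚₚ.≤-trans (orbit-≥1 n) (ℚₚ.<⇒≤ (orbit-increasing n))

ζⁿ-↦ : ∀ n → (n ×ᴳ ζ) ∶ conicPoint 0ℚ 1ℚ ↦ uncurry conicPoint (orbit n)
ζⁿ-↦ zero    = mapsto λ i → ι-at (var i) (conicPoint 0ℚ 1ℚ)
-- `suc n ×ᴳ ζ` unfolds to `ζ ∙ (n ×ᴳ ζ)`, so the new factor acts last, as `step` does in `orbit`.
ζⁿ-↦ (suc n) = ∙-↦ ζ (n ×ᴳ ζ) (ζⁿ-↦ n)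
  (ζ-↦ (proj₁ (orbit n)) (proj₂ (orbit n)) (orbit-conic n)
    {{proj₁ (orbit-positive n)}} {{proj₂ (orbit-positive n)}})

lemma2p9 : HasInfiniteOrder Bir ζ
lemma2p9 (suc n) ζ¹⁺ⁿ≋id = ℚₚ.<-irrefl v₀≡v (ℚₚ.≤-<-trans (orbit-≥1 n) (orbit-increasing n))
  where
  X = conicPoint 0ℚ 1ℚ
  -- The power of `ζ` and the identity are both defined at `X`, so their values there must coincide.
  fixed : ∀ i → X i ≡ uncurry conicPoint (orbit (suc n)) i
  fixed i = ≡.sym (at-unique (conicPoint-OnX₄ 0ℚ 1ℚ ≡.refl) (ζ¹⁺ⁿ≋id i)
    (coord-at (ζⁿ-↦ (suc n)) i) (ι-at (var i) X))
  x₂-x₃ : ∀ g v → ⟦ x₂ - x₃ ⟧ (conicPoint g v) ≡ v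
  x₂-x₃ = solve 2 (λ g v → Symbolic.⟦ x₂ - x₃ ⟧ (Symbolic.conicPoint g v) := v) ≡.refl
  -- The coordinate v would return to its initial value 1, although it has strictly increased.
  v₀≡v : 1ℚ ≡ proj₂ (orbit (suc n))
  v₀≡v = ≡.trans (≡.cong₂ ℚ._-_ (fixed i₂) (fixed i₃)) (uncurry x₂-x₃ (orbit (suc n)))
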